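{- For the online Min-Sum Set Cover problem there exist (i) a randomized online algorithm and (ii) a deterministic online algorithm such that, for an absolute constant $C$ and every integer $r\ge 1$, on every input in which all requested sets have cardinality at most $r$, the randomized algorithm is $C r^2$-competitive and the deterministic algorithm is $C r^4$-competitive. (That is: the randomized algorithm is $O(r^2)$-competitive and the deterministic one is $O(r^4)$-competitive.)
   Context: Online Min-Sum Set Cover (MSSC): there is a universe $U$ of $n$ elements. A permutation of $U$ is a bijection $\pi: U\to\{1,\dots,n\}$, $\pi(x)$ being the position of $x$ on the list. An input $\mathcal I$ consists of an initial permutation $\pi_0$ and a sequence of nonempty sets $R_1,\dots,R_m\subseteq U$ revealed one at a time. Upon seeing $R_t$, the algorithm first pays the access cost $\min_{x\in R_t}\pi_{t-1}(x)$, then chooses a new permutation $\pi_t$ (possibly equal to $\pi_{t-1}$) and pays the reordering cost $d(\pi_{t-1},\pi_t)$, the number of pairs of elements whose relative order differs in $\pi_{t-1}$ and $\pi_t$ (equivalently the minimum number of swaps of adjacent elements transforming one into the other). An online algorithm chooses $\pi_t$ without knowledge of $R_{t+1},R_{t+2},\dots$ or of $m$. $\mathrm{ALG}(\mathcal I)$ is the total cost of the algorithm and $\mathrm{OPT}(\mathcal I)$ the minimum total cost of any (offline) sequence of permutations $\pi_1,\dots,\pi_m$ on $\mathcal I$. An algorithm is $c$-competitive (on a class of inputs) if there is $\xi$ such that $\mathrm{ALG}(\mathcal I)\le c\cdot \mathrm{OPT}(\mathcal I)+\xi$ for every input $\mathcal I$ of the class; for randomized algorithms $\mathrm{ALG}(\mathcal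 I)$ is replaced by its expectation over the algorithm's random choices. $r$ denotes the maximum cardinality of the requested sets $R_t$. -}

module Defs where

open import Data.Nat as ℕ using (ℕ; zero; suc; _⊓_; _≤_; _+_)
open import Data.Fin as Fin using (Fin; toℕ)
open import Data.Fin.Subset using (Subset; inside; outside; Nonempty; ∣_∣)
open import Data.Fin.Permutation using (Permutation′; _⟨$⟩ʳ_)
open import Data.Vec using ([]; _∷_)
open import Data.List as List using (List; []; _∷_; filter; length; cartesianProduct; allFin)
open import Data.List.Relation.Unary.All using (All)
open import Data.Product using (_×_; _,_; proj₁; proj₂; Σ; ∃)
open import Data.Integer using (+_)
open import Data.Rational as ℚ using (ℚ; 0ℚ; 1ℚ)
open import Relation.Nullary.Decidable using (_×-dec_)
open import Relation.Binary.PropositionalEquality using (_≡_)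

-- Permutations and costs
--
-- The universe is Fin n.  A permutation π : Permutation′ n is read as the
-- bijection "element ↦ position"; position of x is  π ⟨$⟩ʳ x  (0-based),
-- so the paper's 1-based position π(x) is  suc (toℕ (π ⟨$⟩ʳ x)).

pos : ∀ {n} → Permutation′ n → Fin n → ℕ
pos π x = suc (toℕ (π ⟨$⟩ʳ x))

minIn : ∀ {n} → ℕ → Subset n → (Fin n → ℕ) → ℕ
minIn d [] f = d
minIn d (inside ∷ p) f = f Fin.zero ⊓ minIn d p (λ x → f (Fin.suc x))
minIn d (outside ∷ p) f = minIn d p (λ x → f (Fin.suc x))

-- access cost  min_{x ∈ R} π(x)   (R is always nonempty in valid inputs)
access : ∀ {n} → Permutation′ n → Subset n → ℕ
access {n} π R = minIn n R (pos π)

-- d(π,σ): number of pairs of elements whose relative order differs.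
-- Each such unordered pair {x,y} is counted exactly once, as the ordered
-- pair (x,y) with π(x) < π(y) and σ(y) < σ(x).
dist : ∀ {n} → Permutation′ n → Permutation′ n → ℕ
dist {n} π σ =
  length (filter (λ xy → (pos π (proj₁ xy) ℕ.<? pos π (proj₂ xy))
                           ×-dec (pos σ (proj₂ xy) ℕ.<? pos σ (proj₁ xy)))
                 (cartesianProduct (allFin n) (allFin n)))

ValidInput : ∀ {n} → ℕ → List (Subset n) → Set
ValidInput r Rs = All (λ R → Nonempty R × ∣ R ∣ ≤ r) Rs

-- offline solution: σ t is the permutation π_{t+1} chosen after request t+1
offCost : ∀ {n} → Permutation′ n → (ℕ → Permutation′ n) → List (Subset n) → ℕ
offCost π σ [] = 0
offCost π σ (R ∷ Rs) = access π R + dist π (σ 0) + offCost (σ 0) (λ t → σ (suc t)) Rs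

-- Deterministic online algorithms
--
-- Given the initial permutation π₀ and the requests revealed so far
-- (most recent first: R_t ∷ R_{t-1} ∷ … ∷ R_1), output π_t.
-- The algorithm is uniform in n and does not know future requests or m.

DetAlg : Set
DetAlg = ∀ {n} → Permutation′ n → List (Subset n) → Permutation′ n

detCostFrom : ∀ {n} → DetAlg → Permutation′ n → List (Subset n) →
              Permutation′ n → List (Subset n) → ℕ
detCostFrom A π₀ hist π [] = 0
detCostFrom A π₀ hist π (R ∷ Rs) =
  let π′ = A π₀ (R ∷ hist) in
  access π R + dist π π′ + detCostFrom A π₀ (R ∷ hist) π′ Rs

detCost : ∀ {n} → DetAlg → Permutation′ n → List (Subset n) → ℕ
detCost A π₀ Rs = detCostFrom A π₀ [] π₀ Rs

-- Randomized online algorithms (behavioural form, finitely supported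
-- distributions with rational probabilities).
--
-- Given π₀, the past (request, chosen permutation) pairs (most recent
-- first) and the current request R_t, output a probability distribution
-- over the new permutation π_t.

Dist : Set → Set
Dist A = List (ℚ × A)

weightSum : ∀ {A : Set} → Dist A → ℚ
weightSum [] = 0ℚ
weightSum ((p , _) ∷ ps) = p ℚ.+ weightSum ps

IsDist : ∀ {A : Set} → Dist A → Set
IsDist D = All (λ pa → 0ℚ ℚ.≤ proj₁ pa) D × weightSum D ≡ 1ℚ

record RandAlg : Set where
  field
    choose : ∀ {n} → Permutation′ n → List (Subset n × Permutation′ n) →
             Subset n → Dist (Permutation′ n)
    valid  : ∀ {n} (π₀ : Permutation′ n) hist R → IsDist (choose π₀ hist R)

ℕtoℚ : ℕ → ℚ
ℕtoℚ k = + k ℚ./ 1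

expCostFrom : ∀ {n} → RandAlg → Permutation′ n →
              List (Subset n × Permutation′ n) →
              Permutation′ n → List (Subset n) → ℚ
expCostFrom A π₀ hist π [] = 0ℚ
expCostFrom A π₀ hist π (R ∷ Rs) =
  ℕtoℚ (access π R) ℚ.+ avg (RandAlg.choose A π₀ hist R)
  where
  avg : Dist _ → ℚ
  avg [] = 0ℚ
  avg ((p , σ) ∷ ps) =
    p ℚ.* (ℕtoℚ (dist π σ) ℚ.+ expCostFrom A π₀ ((R , σ) ∷ hist) σ Rs)
    ℚ.+ avg ps

expCost : ∀ {n} → RandAlg → Permutation′ n → List (Subset n) → ℚ
expCost A π₀ Rs = expCostFrom A π₀ [] π₀ Rs

{-# OPTIONS --safe #-}

-- Randomized algorithm: on a request R with access cost ℓ, pick x ∈ R uniformly and move x to the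
-- front with probability ℓ / pos x, so that the expected cost is at most 2ℓ.  Against a reference
-- list τ use the potential Φ = Σ_z κ (pos π z − κ pos τ z)⁺ with κ = 3r.  Moving x from position p
-- to the front raises only the terms with κ pos τ z ≤ p, of which there are at most p / κ, hence
-- raises Φ by at most p; but if x is the element of R accessed by τ, it also removes a term of
-- at least κ (p − κ pos τ x).  In expectation this pays for the request up to κ² times the cost
-- of τ, and a swap in τ raises Φ by at most κ².
--
-- Deterministic algorithm: τ may itself be a random list, as long as it is independent of the next
-- random move.  So keep the exact distribution of the simulated randomized algorithm and make the
-- move minimizing cost plus expected potential against it; by averaging this is no worse than the
-- random move, and it costs κ² times the simulation, hence κ⁴ times the optimum.  The algorithm
-- does not know r and uses the largest request seen so far instead.
module Submission where

open import Defs
open import Data.Nat using (ℕ; _+_; _*_; _^_; _≤_)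
open import Data.List using (List)
open import Data.Product using (Σ; _×_; ∃)
open import Data.Fin.Subset using (Subset)
open import Data.Fin.Permutation using (Permutation′)
open import Data.Rational as ℚ using (ℚ)

import Data.Fin as Fin
import Data.Fin.Properties as Fin
import Data.Integer as ℤ
import Data.Integer.Properties as ℤ
import Data.List as List
import Data.List.Extrema
import Data.List.Properties as List
import Data.List.Relation.Unary.All as All
import Data.List.Relation.Unary.All.Properties as All
import Data.List.Relation.Unary.Any as Any
import Data.List.Relation.Unary.Any.Properties as Any
import Data.Nat as ℕ
import Data.Nat.Properties as ℕ
import Data.Rational.Properties as ℚ
import Data.Rational.Unnormalised as ℚᵘ
import Data.Rational.Unnormalised.Properties as ℚᵘ
open import Algebra.Properties.CommutativeMonoid.Sum ℕ.+-0-commutativeMonoid using (sum; sum-cong-≗; sum-replicate-zero; sum-remove; sum-permute; ∑-distrib-+; ∑-comm)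
open import Algebra.Properties.Semiring.Sum ℕ.+-*-semiring using (*-distribˡ-sum)
open import Data.Bool using (if_then_else_)
open import Data.Fin using (Fin; zero; suc; toℕ; punchIn; punchOut)
open import Data.Fin.Permutation using (_⟨$⟩ʳ_; _∘ₚ_; insert; id)
open import Data.Fin.Subset using (Nonempty; inside; outside; ∣_∣)
open import Data.List using ([]; _∷_; filter; length; cartesianProduct; tabulate)
open import Data.List.Relation.Unary.All using (All; []; _∷_)
open import Data.List.Relation.Unary.Any using (Any; here; there)
open import Data.Nat using (zero; suc; _∸_; _⊔_; _⊓_; _<_; z≤n; s≤s; _<?_; _≤?_)
open import Data.Nat.Properties hiding (_<?_; _≤?_)
open import Data.Nat.Solver using () renaming (module +-*-Solver to ℕ-Solver)
open import Data.Product using (_,_; proj₁; proj₂)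
open import Data.Rational using (0ℚ; 1ℚ)
open import Data.Rational.Solver using (module +-*-Solver)
open import Data.Sum using (_⊎_; inj₁; inj₂)
open import Data.Vec using ([]; _∷_; there)
open import Function using (_∘_; Injective)
open import Function.Bundles using (Injection)
open import Function.Properties.Inverse using (↔⇒↣)
open import Level using (0ℓ)
open import Relation.Binary using (tri<; tri≈; tri>)
open import Relation.Binary.Bundles using (DecTotalOrder)
open import Relation.Binary.PropositionalEquality
open import Relation.Nullary using (Dec; yes; no; does; ¬_; contradiction)
open import Relation.Nullary.Decidable using (_×-dec_)
open import Relation.Unary using (Pred; Decidable)

private variable
  n : ℕ
  A B X Y : Set

-- Finite sums and inversions

𝟙 : Dec X → ℕ
𝟙 d = if does d then 1 else 0

𝟙-mono : (X → Y) → (d : Dec X) (e : Dec Y) → 𝟙 d ≤ 𝟙 e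
𝟙-mono f (no _)  e       = z≤n
𝟙-mono f (yes p) (yes q) = ≤-refl
𝟙-mono f (yes p) (no ¬q) = contradiction (f p) ¬q

𝟙-no : ¬ X → (d : Dec X) → 𝟙 d ≡ 0
𝟙-no ¬p (yes p) = contradiction p ¬p
𝟙-no ¬p (no _)  = refl

sum-mono : {f g : Fin n → ℕ} → (∀ i → f i ≤ g i) → sum f ≤ sum g
sum-mono {zero}  f≤g = z≤n
sum-mono {suc n} f≤g = +-mono-≤ (f≤g zero) (sum-mono (f≤g ∘ suc))

sum-zero : {f : Fin n → ℕ} → (∀ i → f i ≡ 0) → sum f ≡ 0
sum-zero {n} f≡0 = trans (sum-cong-≗ f≡0) (sum-replicate-zero n)

sum-≤-bound : {f : Fin n → ℕ} {b : ℕ} → (∀ i → f i ≤ b) → sum f ≤ n * b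
sum-≤-bound {zero}  f≤b = z≤n
sum-≤-bound {suc n} f≤b = +-mono-≤ (f≤b zero) (sum-≤-bound (f≤b ∘ suc))

sum-single : {f : Fin n → ℕ} (x : Fin n) → (∀ i → i ≢ x → f i ≡ 0) → sum f ≡ f x
sum-single {suc n} {f} x f≡0 = begin
  sum f                               ≡⟨ sum-remove {i = x} f ⟩
  f x + sum (λ j → f (punchIn x j))   ≡⟨ cong (f x +_) (sum-zero λ j → f≡0 _ (Fin.punchInᵢ≢i x j)) ⟩
  f x + 0                             ≡⟨ +-identityʳ _ ⟩
  f x                                 ∎
  where open ≡-Reasoning

sum-mono-slack : {f g : Fin n → ℕ} {c : ℕ} (x : Fin n) →
                 (∀ i → i ≢ x → f i ≤ g i) → f x + c ≤ g x → sum f + c ≤ sum g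
sum-mono-slack {suc n} {f} {g} {c} x f≤g fx+c≤gx = begin
  sum f + c                                 ≡⟨ cong (_+ c) (sum-remove {i = x} f) ⟩
  f x + sum (λ j → f (punchIn x j)) + c     ≡⟨ +-assoc (f x) _ c ⟩
  f x + (sum (λ j → f (punchIn x j)) + c)   ≡⟨ cong (f x +_) (+-comm _ c) ⟩
  f x + (c + sum (λ j → f (punchIn x j)))   ≡⟨ +-assoc (f x) c _ ⟨
  f x + c + sum (λ j → f (punchIn x j))     ≤⟨ +-mono-≤ fx+c≤gx (sum-mono λ j → f≤g _ (Fin.punchInᵢ≢i x j)) ⟩
  g x + sum (λ j → g (punchIn x j))         ≡⟨ sum-remove {i = x} g ⟨
  sum g                                     ∎
  where open ≤-Reasoning

module _ {A : Set} {P : Pred A 0ℓ} (P? : Decidable P) where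

  length-filter-tabulate : (f : Fin n → A) →
                           length (filter P? (tabulate f)) ≡ sum (λ i → 𝟙 (P? (f i)))
  length-filter-tabulate {zero}  f = refl
  length-filter-tabulate {suc n} f with P? (f zero)
  ... | yes _ = cong suc (length-filter-tabulate (f ∘ suc))
  ... | no _  = length-filter-tabulate (f ∘ suc)

module _ {A B : Set} {P : Pred (A × B) 0ℓ} (P? : Decidable P) where

  length-filter-cartesianProduct : ∀ {m} (f : Fin m → A) (g : Fin n → B) →
    length (filter P? (cartesianProduct (tabulate f) (tabulate g))) ≡
    sum (λ i → sum (λ j → 𝟙 (P? (f i , g j))))
  length-filter-cartesianProduct {m = zero}  f g = refl
  length-filter-cartesianProduct {m = suc m} f g = begin
    length (filter P? (row List.++ rest))
      ≡⟨ cong length (List.filter-++ P? row rest) ⟩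
    length (filter P? row List.++ filter P? rest)
      ≡⟨ List.length-++ (filter P? row) ⟩
    length (filter P? row) + length (filter P? rest)
      ≡⟨ cong₂ _+_ (trans (cong (length ∘ filter P?) (List.map-tabulate g (f zero ,_)))
                          (length-filter-tabulate P? (λ j → f zero , g j)))
                   (length-filter-cartesianProduct (f ∘ suc) g) ⟩
    _ ∎
    where
    open ≡-Reasoning
    row = List.map (f zero ,_) (tabulate g)
    rest = cartesianProduct (tabulate (f ∘ suc)) (tabulate g)

Inverted : Permutation′ n → Permutation′ n → Fin n → Fin n → Set
Inverted π σ x y = pos π x < pos π y × pos σ y < pos σ x

inverted? : ∀ (π σ : Permutation′ n) x y → Dec (Inverted π σ x y)
inverted? π σ x y = (pos π x <? pos π y) ×-dec (pos σ y <? pos σ x)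

dist≡sum : (π σ : Permutation′ n) → dist π σ ≡ sum (λ x → sum (λ y → 𝟙 (inverted? π σ x y)))
dist≡sum π σ = length-filter-cartesianProduct (λ (x , y) → inverted? π σ x y) (λ x → x) (λ x → x)

dist-refl : (π : Permutation′ n) → dist π π ≡ 0
dist-refl π = trans (dist≡sum π π) (sum-zero λ x → sum-zero λ y →
  𝟙-no (λ (x<y , y<x) → <-asym x<y y<x) (inverted? π π x y))

pos-injective : (π : Permutation′ n) → Injective _≡_ _≡_ (pos π)
pos-injective π = Injection.injective (↔⇒↣ π) ∘ Fin.toℕ-injective ∘ suc-injective

pos≤n : (π : Permutation′ n) (x : Fin n) → pos π x ≤ n
pos≤n π x = Fin.toℕ<n (π ⟨$⟩ʳ x)

-- Removing the first index lowers the threshold `b` by `κ`. If `κ ≤ b`, the first multiple costs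
-- exactly that `κ`; otherwise it counts for nothing, and the truncated `b ∸ κ` is still at most
-- `b`.
count-multiples : ∀ n κ b → κ * sum {n} (λ i → 𝟙 (κ * suc (toℕ i) ≤? b)) ≤ b
count-multiples zero    κ b = subst (_≤ b) (sym (*-zeroʳ κ)) z≤n
count-multiples (suc n) κ b = begin
  κ * (𝟙 (κ * 1 ≤? b) + sum {n} (λ i → 𝟙 (κ * suc (suc (toℕ i)) ≤? b)))
    ≡⟨ *-distribˡ-+ κ (𝟙 (κ * 1 ≤? b)) _ ⟩
  κ * 𝟙 (κ * 1 ≤? b) + κ * sum {n} (λ i → 𝟙 (κ * suc (suc (toℕ i)) ≤? b))
    ≤⟨ +-monoʳ-≤ (κ * 𝟙 (κ * 1 ≤? b)) (*-monoʳ-≤ κ (sum-mono {n} λ i → 𝟙-mono (shift (toℕ i)) (_ ≤? b) (_ ≤? _))) ⟩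
  κ * 𝟙 (κ * 1 ≤? b) + κ * sum {n} (λ i → 𝟙 (κ * suc (toℕ i) ≤? b ∸ κ))
    ≤⟨ +-monoʳ-≤ (κ * 𝟙 (κ * 1 ≤? b)) (count-multiples n κ (b ∸ κ)) ⟩
  κ * 𝟙 (κ * 1 ≤? b) + (b ∸ κ)
    ≤⟨ head (κ * 1 ≤? b) ⟩
  b ∎
  where
  open ≤-Reasoning
  shift : ∀ i → κ * suc (suc i) ≤ b → κ * suc i ≤ b ∸ κ
  shift i le = m+n≤o⇒m≤o∸n (κ * suc i) (subst (_≤ b) (trans (*-suc κ (suc i)) (+-comm κ _)) le)
  head : (d : Dec (κ * 1 ≤ b)) → κ * 𝟙 d + (b ∸ κ) ≤ b
  head (yes le) = ≤-reflexive (trans (cong (_+ (b ∸ κ)) (*-identityʳ κ)) (m+[n∸m]≡n (subst (_≤ b) (*-identityʳ κ) le)))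
  head (no _)   = ≤-trans (≤-reflexive (cong (_+ (b ∸ κ)) (*-zeroʳ κ))) (m∸n≤m b κ)

count-pos-multiples : (π : Permutation′ n) → ∀ κ b → κ * sum (λ x → 𝟙 (κ * pos π x ≤? b)) ≤ b
count-pos-multiples {n} π κ b =
  subst (λ s → κ * s ≤ b) (sum-permute (λ i → 𝟙 (κ * suc (toℕ i) ≤? b)) π) (count-multiples n κ b)

count-below : (π : Permutation′ n) → ∀ b → sum (λ x → 𝟙 (pos π x ≤? b)) ≤ b
count-below {n} π b = begin
  sum (λ x → 𝟙 (pos π x ≤? b))          ≤⟨ sum-mono {n} (λ x → 𝟙-mono (subst (_≤ b) (sym (*-identityˡ (pos π x)))) (pos π x ≤? b) (1 * pos π x ≤? b)) ⟩
  sum (λ x → 𝟙 (1 * pos π x ≤? b))      ≡⟨ *-identityˡ _ ⟨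
  1 * sum (λ x → 𝟙 (1 * pos π x ≤? b))  ≤⟨ count-pos-multiples π 1 b ⟩
  b                                     ∎
  where open ≤-Reasoning

count-toℕ< : ∀ {n k} → k ≤ n → sum {n} (λ i → 𝟙 (suc (toℕ i) ≤? k)) ≡ k
count-toℕ< {n} z≤n = sum-zero {n} λ i → refl
count-toℕ< (s≤s {m} {n} k≤n) = cong suc (trans (sum-cong-≗ {n} λ i → refl) (count-toℕ< k≤n))

pos≡count : (π : Permutation′ n) (y : Fin n) → pos π y ≡ suc (sum (λ x → 𝟙 (pos π x <? pos π y)))
pos≡count π y = cong suc (trans (sym (count-toℕ< (<⇒≤ (Fin.toℕ<n (π ⟨$⟩ʳ y)))))
  (sum-permute (λ i → 𝟙 (suc (toℕ i) ≤? toℕ (π ⟨$⟩ʳ y))) π))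

-- An element gains places only by overtaking: whoever precedes `y` in `τ` either still does so in
-- `τ′` or forms an inverted pair with `y`. Summed over `y`, each inverted pair is charged once, to
-- the element that overtakes.
sum-pos∸pos≤dist : (τ τ′ : Permutation′ n) → sum (λ z → pos τ z ∸ pos τ′ z) ≤ dist τ τ′
sum-pos∸pos≤dist τ τ′ = begin
  sum (λ y → pos τ y ∸ pos τ′ y)                    ≤⟨ sum-mono drop ⟩
  sum (λ y → sum (λ x → 𝟙 (inverted? τ τ′ x y)))    ≡⟨ ∑-comm (λ y x → 𝟙 (inverted? τ τ′ x y)) ⟩
  sum (λ x → sum (λ y → 𝟙 (inverted? τ τ′ x y)))    ≡⟨ dist≡sum τ τ′ ⟨
  dist τ τ′                                         ∎
  where
  open ≤-Reasoning
  pointwise : ∀ x y → 𝟙 (pos τ x <? pos τ y) ≤ 𝟙 (pos τ′ x <? pos τ′ y) + 𝟙 (inverted? τ τ′ x y)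
  pointwise x y with <-cmp (pos τ′ x) (pos τ′ y)
  ... | tri< lt _ _ = ≤-trans (𝟙-mono (λ _ → lt) (pos τ x <? pos τ y) (pos τ′ x <? pos τ′ y)) (m≤m+n _ _)
  ... | tri≈ _ eq _ = ≤-trans (≤-reflexive (𝟙-no (<-irrefl (cong (pos τ) (pos-injective τ′ eq))) (pos τ x <? pos τ y))) z≤n
  ... | tri> _ _ gt = ≤-trans (𝟙-mono (_, gt) (_ <? _) (inverted? τ τ′ x y)) (m≤n+m _ _)
  drop : ∀ y → pos τ y ∸ pos τ′ y ≤ sum (λ x → 𝟙 (inverted? τ τ′ x y))
  drop y = m≤n+o⇒m∸n≤o (pos τ y) (pos τ′ y) (begin
    pos τ y ≡⟨ pos≡count τ y ⟩
    suc (sum (λ x → 𝟙 (pos τ x <? pos τ y)))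
      ≤⟨ s≤s (sum-mono λ x → pointwise x y) ⟩
    suc (sum (λ x → 𝟙 (pos τ′ x <? pos τ′ y) + 𝟙 (inverted? τ τ′ x y)))
      ≡⟨ cong suc (∑-distrib-+ (λ x → 𝟙 (pos τ′ x <? pos τ′ y)) _) ⟩
    suc (sum (λ x → 𝟙 (pos τ′ x <? pos τ′ y)) + sum (λ x → 𝟙 (inverted? τ τ′ x y)))
      ≡⟨ cong (_+ sum (λ x → 𝟙 (inverted? τ τ′ x y))) (pos≡count τ′ y) ⟨
    pos τ′ y + sum (λ x → 𝟙 (inverted? τ τ′ x y)) ∎)

-- Move to front and the potential

front : Fin n → Permutation′ n
front {suc n} i = insert i zero id

-- `front` acts on positions, so it is composed after `π`. It sends position `i` to 0 and keeps the
-- order of the others: those before `i` move back by one, those behind it stay.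
moveToFront : Fin n → Permutation′ n → Permutation′ n
moveToFront x π = π ∘ₚ front (π ⟨$⟩ʳ x)

punchOut-≤ : {i j : Fin (suc n)} (i≢j : i ≢ j) → toℕ (punchOut i≢j) ≤ toℕ j
punchOut-≤ {n}     {zero}  {zero}  i≢j = contradiction refl i≢j
punchOut-≤ {n}     {zero}  {suc j} i≢j = n≤1+n _
punchOut-≤ {suc n} {suc i} {zero}  i≢j = z≤n
punchOut-≤ {suc n} {suc i} {suc j} i≢j = s≤s (punchOut-≤ (i≢j ∘ cong suc))

punchOut-< : {i j : Fin (suc n)} (i≢j : i ≢ j) → toℕ i ≤ toℕ j → toℕ (punchOut i≢j) < toℕ j
punchOut-< {n}     {zero}  {zero}  i≢j _ = contradiction refl i≢j
punchOut-< {n}     {zero}  {suc j} i≢j _ = ≤-refl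
punchOut-< {suc n} {suc i} {suc j} i≢j (s≤s le) = s≤s (punchOut-< (i≢j ∘ cong suc) le)

front-self : (i : Fin n) → toℕ (front i ⟨$⟩ʳ i) ≡ 0
front-self {suc n} i with i Fin.≟ i
... | yes _  = refl
... | no i≢i = contradiction refl i≢i

front-≤ : (i j : Fin n) → toℕ (front i ⟨$⟩ʳ j) ≤ suc (toℕ j)
front-≤ {suc n} i j with i Fin.≟ j
... | yes _  = z≤n
... | no i≢j = s≤s (punchOut-≤ i≢j)

front-fixes-behind : (i j : Fin n) → toℕ i ≤ toℕ j → toℕ (front i ⟨$⟩ʳ j) ≤ toℕ j
front-fixes-behind {suc n} i j i≤j with i Fin.≟ j
... | yes _  = z≤n
... | no i≢j = punchOut-< i≢j i≤j

front-mono : (i : Fin n) {j k : Fin n} → i ≢ k → toℕ j ≤ toℕ k → toℕ (front i ⟨$⟩ʳ j) ≤ toℕ (front i ⟨$⟩ʳ k)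
front-mono {suc n} i {j} {k} i≢k j≤k with i Fin.≟ j | i Fin.≟ k
... | yes _  | _        = z≤n
... | no _   | yes i≡k  = contradiction i≡k i≢k
... | no i≢j | no  i≢k′ = s≤s (Fin.punchOut-mono-≤ i≢j i≢k′ j≤k)

pos-moveToFront-self : (x : Fin n) (π : Permutation′ n) → pos (moveToFront x π) x ≡ 1
pos-moveToFront-self x π = cong suc (front-self (π ⟨$⟩ʳ x))

-- Only `x` overtakes anything, and only elements that stood before it. Exchanging the sums puts the
-- overtaking element outside, so that the outer sum collapses to one term.
dist-moveToFront≤pos : (x : Fin n) (π : Permutation′ n) → dist π (moveToFront x π) ≤ pos π x
dist-moveToFront≤pos {n} x π = begin
  dist π π′                                          ≡⟨ dist≡sum π π′ ⟩
  sum (λ u → sum (λ v → 𝟙 (inverted? π π′ u v)))     ≡⟨ ∑-comm (λ u v → 𝟙 (inverted? π π′ u v)) ⟩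
  sum (λ v → sum (λ u → 𝟙 (inverted? π π′ u v)))     ≡⟨ sum-single x (λ v v≢x → sum-zero λ u → 𝟙-no (keeps-order v≢x) (inverted? π π′ u v)) ⟩
  sum (λ u → 𝟙 (inverted? π π′ u x))                 ≤⟨ sum-mono (λ u → 𝟙-mono (<⇒≤ ∘ proj₁) (inverted? π π′ u x) (pos π u ≤? pos π x)) ⟩
  sum (λ u → 𝟙 (pos π u ≤? pos π x))                 ≤⟨ count-below π (pos π x) ⟩
  pos π x                                            ∎
  where
  open ≤-Reasoning
  π′ = moveToFront x π
  keeps-order : ∀ {u v} → v ≢ x → ¬ Inverted π π′ u v
  keeps-order {u} {v} v≢x (u<v , v<′u) = <⇒≱ v<′u (s≤s (front-mono (π ⟨$⟩ʳ x)
    (v≢x ∘ sym ∘ Injection.injective (↔⇒↣ π)) (<⇒≤ (ℕ.s≤s⁻¹ u<v))))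

-- The weight κ outside is balanced by the threshold κ inside: at most b/κ elements
-- with κ · pos τ z ≤ b can be pushed back by moving an element from position b to the front.
Φ : ℕ → Permutation′ n → Permutation′ n → ℕ
Φ κ π τ = sum (λ z → κ * (pos π z ∸ κ * pos τ z))

Φ-bound : ∀ κ (π τ : Permutation′ n) → Φ κ π τ ≤ n * (κ * n)
Φ-bound κ π τ = sum-≤-bound λ z → *-monoʳ-≤ κ (≤-trans (m∸n≤m (pos π z) (κ * pos τ z)) (pos≤n π z))

Φ-moveToFront : ∀ κ (x : Fin n) (π τ : Permutation′ n) →
  Φ κ (moveToFront x π) τ + κ * (pos π x ∸ κ * pos τ x) ≤ Φ κ π τ + pos π x
Φ-moveToFront κ x π τ = begin
  Φ κ π′ τ + κ * (pos π x ∸ κ * pos τ x)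
    ≤⟨ sum-mono-slack x (λ z _ → others z) self ⟩
  sum (λ z → κ * (pos π z ∸ κ * pos τ z) + κ * passed z)
    ≡⟨ ∑-distrib-+ (λ z → κ * (pos π z ∸ κ * pos τ z)) _ ⟩
  Φ κ π τ + sum (λ z → κ * passed z)
    ≡⟨ cong (Φ κ π τ +_) (*-distribˡ-sum κ passed) ⟨
  Φ κ π τ + κ * sum passed
    ≤⟨ +-monoʳ-≤ (Φ κ π τ) (count-pos-multiples τ κ (pos π x)) ⟩
  Φ κ π τ + pos π x ∎
  where
  open ≤-Reasoning
  π′ = moveToFront x π
  passed : _ → ℕ
  passed z = 𝟙 (κ * pos τ z ≤? pos π x)
  grow : ∀ z (d : Dec (κ * pos τ z ≤ pos π x)) → pos π′ z ∸ κ * pos τ z ≤ (pos π z ∸ κ * pos τ z) + 𝟙 d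
  grow z (yes _) = m≤n+o⇒m∸n≤o (pos π′ z) (κ * pos τ z) (begin
    pos π′ z  ≤⟨ s≤s (front-≤ (π ⟨$⟩ʳ x) (π ⟨$⟩ʳ z)) ⟩
    1 + pos π z ≤⟨ +-monoʳ-≤ 1 (m≤n+m∸n (pos π z) (κ * pos τ z)) ⟩
    1 + (κ * pos τ z + (pos π z ∸ κ * pos τ z)) ≡⟨ +-comm 1 _ ⟩
    κ * pos τ z + (pos π z ∸ κ * pos τ z) + 1 ≡⟨ +-assoc (κ * pos τ z) _ 1 ⟩
    κ * pos τ z + ((pos π z ∸ κ * pos τ z) + 1) ∎)
  -- Here `κ * pos τ z` exceeds `pos π x`. An element not before `x` does not move back; one before
  -- `x` ends at `1 + pos π x` at most, still within its threshold, so its term is zero.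
  grow z (no far) with ≤-total (pos π x) (pos π z)
  ... | inj₁ x≤z = ≤-trans (∸-monoˡ-≤ (κ * pos τ z) (s≤s (front-fixes-behind (π ⟨$⟩ʳ x) (π ⟨$⟩ʳ z) (ℕ.s≤s⁻¹ x≤z)))) (m≤m+n _ 0)
  ... | inj₂ z≤x = ≤-trans (≤-reflexive (m≤n⇒m∸n≡0 (begin
    pos π′ z     ≤⟨ s≤s (front-≤ (π ⟨$⟩ʳ x) (π ⟨$⟩ʳ z)) ⟩
    1 + pos π z  ≤⟨ s≤s z≤x ⟩
    1 + pos π x  ≤⟨ ≰⇒> far ⟩
    κ * pos τ z  ∎))) z≤n
  others : ∀ z → κ * (pos π′ z ∸ κ * pos τ z) ≤ κ * (pos π z ∸ κ * pos τ z) + κ * passed z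
  others z = ≤-trans (*-monoʳ-≤ κ (grow z (_ ≤? _))) (≤-reflexive (*-distribˡ-+ κ _ (passed z)))
  -- `x` lands at position 1, within its threshold as soon as `κ` is positive; for `κ = 0` the outer
  -- factor kills the term.
  vanishes : ∀ κ → κ * (1 ∸ κ * pos τ x) ≡ 0
  vanishes zero    = refl
  vanishes (suc κ) = trans (cong (suc κ *_) (m≤n⇒m∸n≡0 {1} {suc κ * pos τ x} (s≤s z≤n))) (*-zeroʳ (suc κ))
  self : κ * (pos π′ x ∸ κ * pos τ x) + κ * (pos π x ∸ κ * pos τ x) ≤ κ * (pos π x ∸ κ * pos τ x) + κ * passed x
  self = begin
    κ * (pos π′ x ∸ κ * pos τ x) + κ * (pos π x ∸ κ * pos τ x)
      ≡⟨ cong (λ p → κ * (p ∸ κ * pos τ x) + κ * (pos π x ∸ κ * pos τ x)) (pos-moveToFront-self x π) ⟩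
    κ * (1 ∸ κ * pos τ x) + κ * (pos π x ∸ κ * pos τ x)
      ≡⟨ cong (_+ κ * (pos π x ∸ κ * pos τ x)) (vanishes κ) ⟩
    κ * (pos π x ∸ κ * pos τ x) ≤⟨ m≤m+n _ _ ⟩
    κ * (pos π x ∸ κ * pos τ x) + κ * passed x ∎

-- Each place that `z` gains in the reference list lowers its threshold by `κ`, hence raises its
-- term by at most `κ * κ`; the total gain of places is bounded by the inversions.
Φ-reorder : ∀ κ (π τ τ′ : Permutation′ n) → Φ κ π τ′ ≤ Φ κ π τ + κ * κ * dist τ τ′
Φ-reorder κ π τ τ′ = begin
  Φ κ π τ′
    ≤⟨ sum-mono pointwise ⟩
  sum (λ z → κ * (pos π z ∸ κ * pos τ z) + κ * κ * (pos τ z ∸ pos τ′ z))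
    ≡⟨ ∑-distrib-+ (λ z → κ * (pos π z ∸ κ * pos τ z)) _ ⟩
  Φ κ π τ + sum (λ z → κ * κ * (pos τ z ∸ pos τ′ z))
    ≡⟨ cong (Φ κ π τ +_) (*-distribˡ-sum (κ * κ) (λ z → pos τ z ∸ pos τ′ z)) ⟨
  Φ κ π τ + κ * κ * sum (λ z → pos τ z ∸ pos τ′ z)
    ≤⟨ +-monoʳ-≤ (Φ κ π τ) (*-monoʳ-≤ (κ * κ) (sum-pos∸pos≤dist τ τ′)) ⟩
  Φ κ π τ + κ * κ * dist τ τ′ ∎
  where
  open ≤-Reasoning
  pointwise : ∀ z → κ * (pos π z ∸ κ * pos τ′ z) ≤ κ * (pos π z ∸ κ * pos τ z) + κ * κ * (pos τ z ∸ pos τ′ z)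
  pointwise z = let p = pos π z; o = pos τ z; o′ = pos τ′ z in begin
    κ * (p ∸ κ * o′) ≤⟨ *-monoʳ-≤ κ (m≤n+o⇒m∸n≤o p (κ * o′) (begin
        p                                        ≤⟨ m≤n+m∸n p (κ * o) ⟩
        κ * o + (p ∸ κ * o)                      ≤⟨ +-monoˡ-≤ _ (*-monoʳ-≤ κ (m≤n+m∸n o o′)) ⟩
        κ * (o′ + (o ∸ o′)) + (p ∸ κ * o)        ≡⟨ cong (_+ (p ∸ κ * o)) (*-distribˡ-+ κ o′ _) ⟩
        κ * o′ + κ * (o ∸ o′) + (p ∸ κ * o)      ≡⟨ +-assoc (κ * o′) _ _ ⟩
        κ * o′ + (κ * (o ∸ o′) + (p ∸ κ * o))    ≡⟨ cong (κ * o′ +_) (+-comm (κ * (o ∸ o′)) _) ⟩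
        κ * o′ + ((p ∸ κ * o) + κ * (o ∸ o′))    ∎)) ⟩
    κ * ((p ∸ κ * o) + κ * (o ∸ o′))             ≡⟨ *-distribˡ-+ κ (p ∸ κ * o) _ ⟩
    κ * (p ∸ κ * o) + κ * (κ * (o ∸ o′))         ≡⟨ cong (κ * (p ∸ κ * o) +_) (*-assoc κ κ _) ⟨
    κ * (p ∸ κ * o) + κ * κ * (o ∸ o′)           ∎

-- Finitely supported distributions

toℚᵘ-/ : ∀ a d → ℚ.toℚᵘ (ℤ.+ a ℚ./ suc d) ℚᵘ.≃ ℚᵘ.mkℚᵘ (ℤ.+ a) d
toℚᵘ-/ a d = ℚ.toℚᵘ-fromℚᵘ (ℚᵘ.mkℚᵘ (ℤ.+ a) d)

ℕtoℚ-+ : ∀ a b → ℕtoℚ (a ℕ.+ b) ≡ ℕtoℚ a ℚ.+ ℕtoℚ b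
ℕtoℚ-+ a b = ℚ.toℚᵘ-injective (begin-equality
  ℚ.toℚᵘ (ℕtoℚ (a ℕ.+ b))                    ≃⟨ toℚᵘ-/ (a ℕ.+ b) 0 ⟩
  ℚᵘ.mkℚᵘ (ℤ.+ (a ℕ.+ b)) 0                  ≃⟨ ℚᵘ.*≡* (cong (ℤ._* ℤ.1ℤ) (cong₂ ℤ._+_ (sym (ℤ.*-identityʳ (ℤ.+ a))) (sym (ℤ.*-identityʳ (ℤ.+ b))))) ⟩
  ℚᵘ.mkℚᵘ (ℤ.+ a) 0 ℚᵘ.+ ℚᵘ.mkℚᵘ (ℤ.+ b) 0   ≃⟨ ℚᵘ.+-cong (toℚᵘ-/ a 0) (toℚᵘ-/ b 0) ⟨
  ℚ.toℚᵘ (ℕtoℚ a) ℚᵘ.+ ℚ.toℚᵘ (ℕtoℚ b)       ≃⟨ ℚ.toℚᵘ-homo-+ (ℕtoℚ a) (ℕtoℚ b) ⟨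
  ℚ.toℚᵘ (ℕtoℚ a ℚ.+ ℕtoℚ b)                 ∎)
  where open ℚᵘ.≤-Reasoning

ℕtoℚ-* : ∀ a b → ℕtoℚ (a ℕ.* b) ≡ ℕtoℚ a ℚ.* ℕtoℚ b
ℕtoℚ-* a b = ℚ.toℚᵘ-injective (begin-equality
  ℚ.toℚᵘ (ℕtoℚ (a ℕ.* b))                    ≃⟨ toℚᵘ-/ (a ℕ.* b) 0 ⟩
  ℚᵘ.mkℚᵘ (ℤ.+ (a ℕ.* b)) 0                  ≃⟨ ℚᵘ.*≡* (cong (ℤ._* ℤ.1ℤ) (ℤ.pos-* a b)) ⟩
  ℚᵘ.mkℚᵘ (ℤ.+ a) 0 ℚᵘ.* ℚᵘ.mkℚᵘ (ℤ.+ b) 0   ≃⟨ ℚᵘ.*-cong (toℚᵘ-/ a 0) (toℚᵘ-/ b 0) ⟨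
  ℚ.toℚᵘ (ℕtoℚ a) ℚᵘ.* ℚ.toℚᵘ (ℕtoℚ b)       ≃⟨ ℚ.toℚᵘ-homo-* (ℕtoℚ a) (ℕtoℚ b) ⟨
  ℚ.toℚᵘ (ℕtoℚ a ℚ.* ℕtoℚ b)                 ∎)
  where open ℚᵘ.≤-Reasoning

ℕtoℚ-mono : ∀ {a b} → a ℕ.≤ b → ℕtoℚ a ℚ.≤ ℕtoℚ b
ℕtoℚ-mono {a} {b} a≤b = ℚ.toℚᵘ-cancel-≤ (begin
  ℚ.toℚᵘ (ℕtoℚ a)    ≃⟨ toℚᵘ-/ a 0 ⟩
  ℚᵘ.mkℚᵘ (ℤ.+ a) 0  ≤⟨ ℚᵘ.*≤* (ℤ.*-monoʳ-≤-nonNeg ℤ.1ℤ (ℤ.+≤+ a≤b)) ⟩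
  ℚᵘ.mkℚᵘ (ℤ.+ b) 0  ≃⟨ toℚᵘ-/ b 0 ⟨
  ℚ.toℚᵘ (ℕtoℚ b)    ∎)
  where open ℚᵘ.≤-Reasoning

ℕtoℚ-cancel-≤ : ∀ {a b} → ℕtoℚ a ℚ.≤ ℕtoℚ b → a ℕ.≤ b
ℕtoℚ-cancel-≤ {a} {b} le = ℤ.drop‿+≤+ (ℤ.*-cancelʳ-≤-pos (ℤ.+ a) (ℤ.+ b) ℤ.1ℤ (ℚᵘ.drop-*≤* (begin
  ℚᵘ.mkℚᵘ (ℤ.+ a) 0  ≃⟨ toℚᵘ-/ a 0 ⟨
  ℚ.toℚᵘ (ℕtoℚ a)    ≤⟨ ℚ.toℚᵘ-mono-≤ le ⟩
  ℚ.toℚᵘ (ℕtoℚ b)    ≃⟨ toℚᵘ-/ b 0 ⟩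
  ℚᵘ.mkℚᵘ (ℤ.+ b) 0  ∎)))
  where open ℚᵘ.≤-Reasoning

0≤ℕtoℚ : ∀ a → 0ℚ ℚ.≤ ℕtoℚ a
0≤ℕtoℚ a = ℕtoℚ-mono {0} {a} ℕ.z≤n

0≤/ : ∀ a d → 0ℚ ℚ.≤ ℤ.+ a ℚ./ suc d
0≤/ a d = ℚ.nonNegative⁻¹ (ℤ.+ a ℚ./ suc d) {{ℚ.normalize-nonNeg a (suc d)}}

/≤1 : ∀ a d → a ℕ.≤ suc d → ℤ.+ a ℚ./ suc d ℚ.≤ 1ℚ
/≤1 a d a≤d = ℚ.toℚᵘ-cancel-≤ (begin
  ℚ.toℚᵘ (ℤ.+ a ℚ./ suc d)  ≃⟨ toℚᵘ-/ a d ⟩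
  ℚᵘ.mkℚᵘ (ℤ.+ a) d         ≤⟨ ℚᵘ.*≤* (subst₂ ℤ._≤_ (sym (ℤ.*-identityʳ (ℤ.+ a))) (sym (ℤ.*-identityˡ (ℤ.+ suc d))) (ℤ.+≤+ a≤d)) ⟩
  ℚ.toℚᵘ 1ℚ                 ∎)
  where open ℚᵘ.≤-Reasoning

/-*-cancel : ∀ a d → (ℤ.+ a ℚ./ suc d) ℚ.* ℕtoℚ (suc d) ≡ ℕtoℚ a
/-*-cancel a d = ℚ.toℚᵘ-injective (begin-equality
  ℚ.toℚᵘ ((ℤ.+ a ℚ./ suc d) ℚ.* ℕtoℚ (suc d))              ≃⟨ ℚ.toℚᵘ-homo-* (ℤ.+ a ℚ./ suc d) (ℕtoℚ (suc d)) ⟩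
  ℚ.toℚᵘ (ℤ.+ a ℚ./ suc d) ℚᵘ.* ℚ.toℚᵘ (ℕtoℚ (suc d))      ≃⟨ ℚᵘ.*-cong (toℚᵘ-/ a d) (toℚᵘ-/ (suc d) 0) ⟩
  ℚᵘ.mkℚᵘ (ℤ.+ a) d ℚᵘ.* ℚᵘ.mkℚᵘ (ℤ.+ suc d) 0             ≃⟨ ℚᵘ.*≡* (trans (ℤ.*-identityʳ _) (cong (λ e → ℤ.+ a ℤ.* ℤ.+ e) (sym (ℕ.*-identityʳ (suc d))))) ⟩
  ℚᵘ.mkℚᵘ (ℤ.+ a) 0                                        ≃⟨ toℚᵘ-/ a 0 ⟨
  ℚ.toℚᵘ (ℕtoℚ a)                                          ∎)
  where open ℚᵘ.≤-Reasoning

*-monoˡ : ∀ {c p q} → 0ℚ ℚ.≤ c → p ℚ.≤ q → c ℚ.* p ℚ.≤ c ℚ.* q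
*-monoˡ {c} 0≤c p≤q = ℚ.*-monoˡ-≤-nonNeg c {{ℚ.nonNegative 0≤c}} p≤q

0≤* : ∀ {p q} → 0ℚ ℚ.≤ p → 0ℚ ℚ.≤ q → 0ℚ ℚ.≤ p ℚ.* q
0≤* {p} {q} 0≤p 0≤q = subst (ℚ._≤ p ℚ.* q) (ℚ.*-zeroʳ p) (*-monoˡ 0≤p 0≤q)

scale-≤ : ∀ {c p} → c ℚ.≤ 1ℚ → 0ℚ ℚ.≤ p → c ℚ.* p ℚ.≤ p
scale-≤ {c} {p} c≤1 0≤p = subst (c ℚ.* p ℚ.≤_) (ℚ.*-identityˡ p) (ℚ.*-monoʳ-≤-nonNeg p {{ℚ.nonNegative 0≤p}} c≤1)

p≤p+q : ∀ {q} p → 0ℚ ℚ.≤ q → p ℚ.≤ p ℚ.+ q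
p≤p+q {q} p 0≤q = subst (ℚ._≤ p ℚ.+ q) (ℚ.+-identityʳ p) (ℚ.+-monoʳ-≤ p 0≤q)

𝔼 : Dist A → (A → ℚ) → ℚ
𝔼 []             f = 0ℚ
𝔼 ((p , a) ∷ ps) f = p ℚ.* f a ℚ.+ 𝔼 ps f

NonNegWeights : Dist A → Set
NonNegWeights = All (λ pa → 0ℚ ℚ.≤ proj₁ pa)

𝔼-cong : (D : Dist A) {f g : A → ℚ} → (∀ a → f a ≡ g a) → 𝔼 D f ≡ 𝔼 D g
𝔼-cong []             f≡g = refl
𝔼-cong ((p , a) ∷ ps) f≡g = cong₂ (λ x y → p ℚ.* x ℚ.+ y) (f≡g a) (𝔼-cong ps f≡g)

𝔼-+ : (D : Dist A) (f g : A → ℚ) → 𝔼 D (λ a → f a ℚ.+ g a) ≡ 𝔼 D f ℚ.+ 𝔼 D g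
𝔼-+ []             f g = refl
𝔼-+ ((p , a) ∷ ps) f g = trans (cong (p ℚ.* (f a ℚ.+ g a) ℚ.+_) (𝔼-+ ps f g))
  (solve 5 (λ p x y s t → p :* (x :+ y) :+ (s :+ t) := (p :* x :+ s) :+ (p :* y :+ t)) refl p (f a) (g a) (𝔼 ps f) (𝔼 ps g))
  where open +-*-Solver

𝔼-* : (D : Dist A) (c : ℚ) (f : A → ℚ) → 𝔼 D (λ a → c ℚ.* f a) ≡ c ℚ.* 𝔼 D f
𝔼-* []             c f = sym (ℚ.*-zeroʳ c)
𝔼-* ((p , a) ∷ ps) c f = trans (cong (p ℚ.* (c ℚ.* f a) ℚ.+_) (𝔼-* ps c f))
  (solve 4 (λ p c x s → p :* (c :* x) :+ c :* s := c :* (p :* x :+ s)) refl p c (f a) (𝔼 ps f))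
  where open +-*-Solver

𝔼-weightSum : (D : Dist A) (c : ℚ) → 𝔼 D (λ _ → c) ≡ weightSum D ℚ.* c
𝔼-weightSum []             c = sym (ℚ.*-zeroˡ c)
𝔼-weightSum ((p , a) ∷ ps) c = trans (cong (p ℚ.* c ℚ.+_) (𝔼-weightSum ps c)) (sym (ℚ.*-distribʳ-+ c p (weightSum ps)))

𝔼-const : {D : Dist A} → IsDist D → (c : ℚ) → 𝔼 D (λ _ → c) ≡ c
𝔼-const {D = D} (_ , sum≡1) c = trans (𝔼-weightSum D c) (trans (cong (ℚ._* c) sum≡1) (ℚ.*-identityˡ c))

𝔼-const-+ : {D : Dist A} → IsDist D → ∀ c f → 𝔼 D (λ a → c ℚ.+ f a) ≡ c ℚ.+ 𝔼 D f
𝔼-const-+ {D = D} isD c f = trans (𝔼-+ D (λ _ → c) f) (cong (ℚ._+ 𝔼 D f) (𝔼-const isD c))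

-- The comparison is asked for on the listed outcomes only. `best≤𝔼` needs this form, since a
-- minimizer beats only the candidates it was compared with.
𝔼-mono-All : (D : Dist A) {f g : A → ℚ} → NonNegWeights D →
             All (λ a → f a ℚ.≤ g a) (List.map proj₂ D) → 𝔼 D f ℚ.≤ 𝔼 D g
𝔼-mono-All []             []          []          = ℚ.≤-refl
𝔼-mono-All ((p , a) ∷ ps) (0≤p ∷ 0≤ps) (fa≤ga ∷ h) = ℚ.+-mono-≤ (*-monoˡ 0≤p fa≤ga) (𝔼-mono-All ps 0≤ps h)

𝔼-mono : {D : Dist A} {f g : A → ℚ} → IsDist D → (∀ a → f a ℚ.≤ g a) → 𝔼 D f ℚ.≤ 𝔼 D g
𝔼-mono {D = D} (0≤D , _) f≤g = 𝔼-mono-All D 0≤D (All.universal f≤g _)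

𝔼-nonneg : {D : Dist A} {f : A → ℚ} → IsDist D → (∀ a → 0ℚ ℚ.≤ f a) → 0ℚ ℚ.≤ 𝔼 D f
𝔼-nonneg {D = D} {f} isD 0≤f = subst (ℚ._≤ 𝔼 D f) (𝔼-const isD 0ℚ) (𝔼-mono isD 0≤f)

𝔼-swap : (D : Dist A) (D′ : Dist B) (f : A → B → ℚ) →
         𝔼 D (λ a → 𝔼 D′ (f a)) ≡ 𝔼 D′ (λ b → 𝔼 D (λ a → f a b))
𝔼-swap []             D′ f = sym (trans (𝔼-weightSum D′ 0ℚ) (ℚ.*-zeroʳ (weightSum D′)))
𝔼-swap ((p , a) ∷ ps) D′ f = begin
  p ℚ.* 𝔼 D′ (f a) ℚ.+ 𝔼 ps (λ a → 𝔼 D′ (f a))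
    ≡⟨ cong₂ ℚ._+_ (sym (𝔼-* D′ p (f a))) (𝔼-swap ps D′ f) ⟩
  𝔼 D′ (λ b → p ℚ.* f a b) ℚ.+ 𝔼 D′ (λ b → 𝔼 ps (λ a → f a b))
    ≡⟨ 𝔼-+ D′ (λ b → p ℚ.* f a b) _ ⟨
  𝔼 D′ (λ b → p ℚ.* f a b ℚ.+ 𝔼 ps (λ a → f a b)) ∎
  where open ≡-Reasoning

scale : ℚ → Dist A → Dist A
scale q = List.map (λ (p , a) → q ℚ.* p , a)

bind : Dist A → (A → Dist B) → Dist B
bind []             k = []
bind ((p , a) ∷ ps) k = scale p (k a) List.++ bind ps k

𝔼-++ : (D D′ : Dist A) (f : A → ℚ) → 𝔼 (D List.++ D′) f ≡ 𝔼 D f ℚ.+ 𝔼 D′ f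
𝔼-++ []             D′ f = sym (ℚ.+-identityˡ _)
𝔼-++ ((p , a) ∷ ps) D′ f = trans (cong (p ℚ.* f a ℚ.+_) (𝔼-++ ps D′ f)) (sym (ℚ.+-assoc (p ℚ.* f a) _ _))

𝔼-scale : (q : ℚ) (D : Dist A) (f : A → ℚ) → 𝔼 (scale q D) f ≡ q ℚ.* 𝔼 D f
𝔼-scale q []             f = sym (ℚ.*-zeroʳ q)
𝔼-scale q ((p , a) ∷ ps) f = trans (cong (q ℚ.* p ℚ.* f a ℚ.+_) (𝔼-scale q ps f))
  (solve 4 (λ q p x s → q :* p :* x :+ q :* s := q :* (p :* x :+ s)) refl q p (f a) (𝔼 ps f))
  where open +-*-Solver

𝔼-bind : (D : Dist A) (k : A → Dist B) (f : B → ℚ) → 𝔼 (bind D k) f ≡ 𝔼 D (λ a → 𝔼 (k a) f)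
𝔼-bind []             k f = refl
𝔼-bind ((p , a) ∷ ps) k f = trans (𝔼-++ (scale p (k a)) (bind ps k) f)
  (cong₂ ℚ._+_ (𝔼-scale p (k a) f) (𝔼-bind ps k f))

weightSum≡𝔼1 : (D : Dist A) → weightSum D ≡ 𝔼 D (λ _ → 1ℚ)
weightSum≡𝔼1 D = sym (trans (𝔼-weightSum D 1ℚ) (ℚ.*-identityʳ _))

IsDist-bind : {D : Dist A} {k : A → Dist B} → IsDist D → (∀ a → IsDist (k a)) → IsDist (bind D k)
IsDist-bind {A = A} {B = B} {D = D} {k} isD isK = nonneg D (proj₁ isD) , total
  where
  nonneg : (D : Dist A) → NonNegWeights D → NonNegWeights (bind D k)
  nonneg []             []          = []
  nonneg ((p , a) ∷ ps) (0≤p ∷ 0≤ps) =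
    All.++⁺ (All.map⁺ (All.map (0≤* 0≤p) (proj₁ (isK a)))) (nonneg ps 0≤ps)
  open ≡-Reasoning
  total : weightSum (bind D k) ≡ 1ℚ
  total = begin
    weightSum (bind D k)                ≡⟨ weightSum≡𝔼1 (bind D k) ⟩
    𝔼 (bind D k) (λ _ → 1ℚ)             ≡⟨ 𝔼-bind D k (λ _ → 1ℚ) ⟩
    𝔼 D (λ a → 𝔼 (k a) (λ _ → 1ℚ))      ≡⟨ 𝔼-cong D (λ a → 𝔼-const (isK a) 1ℚ) ⟩
    𝔼 D (λ _ → 1ℚ)                      ≡⟨ 𝔼-const isD 1ℚ ⟩
    1ℚ                                  ∎

pure : A → Dist A
pure a = (1ℚ , a) ∷ []

IsDist-pure : (a : A) → IsDist (pure a)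
IsDist-pure a = (0≤ℕtoℚ 1 ∷ []) , ℚ.+-identityʳ 1ℚ

𝔼-pure : (a : A) (f : A → ℚ) → 𝔼 (pure a) f ≡ f a
𝔼-pure a f = trans (ℚ.+-identityʳ _) (ℚ.*-identityˡ (f a))

coin : ℚ → A → A → Dist A
coin u a b = (u , a) ∷ (1ℚ ℚ.- u , b) ∷ []

IsDist-coin : {u : ℚ} → 0ℚ ℚ.≤ u → u ℚ.≤ 1ℚ → (a b : A) → IsDist (coin u a b)
IsDist-coin {u = u} 0≤u u≤1 a b = (0≤u ∷ subst (ℚ._≤ 1ℚ ℚ.- u) (ℚ.+-inverseʳ u) (ℚ.+-monoˡ-≤ (ℚ.- u) u≤1) ∷ []) ,
  solve 1 (λ u → u :+ ((con 1ℚ :- u) :+ con 0ℚ) := con 1ℚ) refl u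
  where open +-*-Solver

-- The nonempty list comes as head and tail, which makes the denominator visibly positive.
uniform : A → List A → Dist A
uniform a as = List.map (ℤ.+ 1 ℚ./ suc (length as) ,_) (a ∷ as)

total : (A → ℚ) → List A → ℚ
total f []       = 0ℚ
total f (a ∷ as) = f a ℚ.+ total f as

𝔼-equal-weights : (v : ℚ) (as : List A) (f : A → ℚ) → 𝔼 (List.map (v ,_) as) f ≡ v ℚ.* total f as
𝔼-equal-weights v []       f = sym (ℚ.*-zeroʳ v)
𝔼-equal-weights v (a ∷ as) f = trans (cong (v ℚ.* f a ℚ.+_) (𝔼-equal-weights v as f)) (sym (ℚ.*-distribˡ-+ v (f a) _))

total-const : (c : ℚ) (as : List A) → total (λ _ → c) as ≡ ℕtoℚ (length as) ℚ.* c
total-const c []       = sym (ℚ.*-zeroˡ c)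
total-const c (a ∷ as) = begin
  c ℚ.+ total (λ _ → c) as                  ≡⟨ cong₂ ℚ._+_ (sym (ℚ.*-identityˡ c)) (total-const c as) ⟩
  1ℚ ℚ.* c ℚ.+ ℕtoℚ (length as) ℚ.* c       ≡⟨ ℚ.*-distribʳ-+ c 1ℚ (ℕtoℚ (length as)) ⟨
  (1ℚ ℚ.+ ℕtoℚ (length as)) ℚ.* c           ≡⟨ cong (ℚ._* c) (ℕtoℚ-+ 1 (length as)) ⟨
  ℕtoℚ (suc (length as)) ℚ.* c              ∎
  where open ≡-Reasoning

𝔼-uniform-const : (a : A) (as : List A) (c : ℚ) → 𝔼 (uniform a as) (λ _ → c) ≡ c
𝔼-uniform-const a as c = begin
  𝔼 (uniform a as) (λ _ → c)                            ≡⟨ 𝔼-equal-weights v (a ∷ as) (λ _ → c) ⟩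
  v ℚ.* total (λ _ → c) (a ∷ as)                        ≡⟨ cong (v ℚ.*_) (total-const c (a ∷ as)) ⟩
  v ℚ.* (ℕtoℚ (suc (length as)) ℚ.* c)                  ≡⟨ ℚ.*-assoc v _ c ⟨
  v ℚ.* ℕtoℚ (suc (length as)) ℚ.* c                    ≡⟨ cong (ℚ._* c) (/-*-cancel 1 (length as)) ⟩
  1ℚ ℚ.* c                                              ≡⟨ ℚ.*-identityˡ c ⟩
  c                                                     ∎
  where
  open ≡-Reasoning
  v = ℤ.+ 1 ℚ./ suc (length as)

IsDist-uniform : (a : A) (as : List A) → IsDist (uniform a as)
IsDist-uniform a as = All.map⁺ (All.universal (λ _ → 0≤/ 1 (length as)) (a ∷ as)) ,
  trans (weightSum≡𝔼1 (uniform a as)) (𝔼-uniform-const a as 1ℚ)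

total-mono-slack : {f : A → ℚ} {b c d : ℚ} (as : List A) →
  All (λ a → f a ℚ.≤ b) as → Any (λ a → f a ℚ.+ c ℚ.≤ b ℚ.+ d) as →
  total f as ℚ.+ c ℚ.≤ total (λ _ → b) as ℚ.+ d
total-mono-slack {f = f} {b} {c} {d} (a ∷ as) (_ ∷ f≤b) (here gain) = begin
  f a ℚ.+ total f as ℚ.+ c                  ≡⟨ solve 3 (λ x s c → x :+ s :+ c := (x :+ c) :+ s) refl (f a) (total f as) c ⟩
  (f a ℚ.+ c) ℚ.+ total f as                ≤⟨ ℚ.+-mono-≤ gain (total-mono as f≤b) ⟩
  (b ℚ.+ d) ℚ.+ total (λ _ → b) as          ≡⟨ solve 3 (λ x s c → (x :+ c) :+ s := x :+ s :+ c) refl b (total (λ _ → b) as) d ⟩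
  b ℚ.+ total (λ _ → b) as ℚ.+ d            ∎
  where
  open ℚ.≤-Reasoning
  open +-*-Solver
  total-mono : ∀ as → All (λ a → f a ℚ.≤ b) as → total f as ℚ.≤ total (λ _ → b) as
  total-mono []       []          = ℚ.≤-refl
  total-mono (a ∷ as) (fa≤b ∷ le) = ℚ.+-mono-≤ fa≤b (total-mono as le)
total-mono-slack {f = f} {b} {c} {d} (a ∷ as) (fa≤b ∷ f≤b) (there gain) = begin
  f a ℚ.+ total f as ℚ.+ c                  ≡⟨ ℚ.+-assoc (f a) _ c ⟩
  f a ℚ.+ (total f as ℚ.+ c)                ≤⟨ ℚ.+-mono-≤ fa≤b (total-mono-slack as f≤b gain) ⟩
  b ℚ.+ (total (λ _ → b) as ℚ.+ d)          ≡⟨ ℚ.+-assoc b _ d ⟨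
  b ℚ.+ total (λ _ → b) as ℚ.+ d            ∎
  where open ℚ.≤-Reasoning

-- The gain of a single outcome survives in the mean with its weight `v`. This combines a bound
-- valid for every element of a request with a better one for the element that the reference list
-- accesses.
𝔼-uniform-slack : {f : A → ℚ} {b c d : ℚ} (a : A) (as : List A) → let v = ℤ.+ 1 ℚ./ suc (length as) in
  All (λ x → f x ℚ.≤ b) (a ∷ as) → Any (λ x → f x ℚ.+ c ℚ.≤ b ℚ.+ d) (a ∷ as) →
  𝔼 (uniform a as) f ℚ.+ v ℚ.* c ℚ.≤ b ℚ.+ v ℚ.* d
𝔼-uniform-slack {f = f} {b} {c} {d} a as f≤b gain = begin
  𝔼 (uniform a as) f ℚ.+ v ℚ.* c                   ≡⟨ cong (ℚ._+ v ℚ.* c) (𝔼-equal-weights v (a ∷ as) f) ⟩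
  v ℚ.* total f (a ∷ as) ℚ.+ v ℚ.* c               ≡⟨ ℚ.*-distribˡ-+ v _ c ⟨
  v ℚ.* (total f (a ∷ as) ℚ.+ c)                   ≤⟨ *-monoˡ (0≤/ 1 (length as)) (total-mono-slack (a ∷ as) f≤b gain) ⟩
  v ℚ.* (total (λ _ → b) (a ∷ as) ℚ.+ d)           ≡⟨ ℚ.*-distribˡ-+ v _ d ⟩
  v ℚ.* total (λ _ → b) (a ∷ as) ℚ.+ v ℚ.* d       ≡⟨ cong (ℚ._+ v ℚ.* d) (𝔼-equal-weights v (a ∷ as) (λ _ → b)) ⟨
  𝔼 (uniform a as) (λ _ → b) ℚ.+ v ℚ.* d           ≡⟨ cong (ℚ._+ v ℚ.* d) (𝔼-uniform-const a as b) ⟩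
  b ℚ.+ v ℚ.* d                                    ∎
  where
  open ℚ.≤-Reasoning
  v = ℤ.+ 1 ℚ./ suc (length as)

-- Averaging arguments

open Data.List.Extrema (DecTotalOrder.totalOrder ℚ.≤-decTotalOrder) using (argmin; f[argmin]≤f[xs])

-- Unfolding best inside potentials makes conversion checking explode.
opaque
  best : (A → ℚ) → A → Dist A → A
  best f a D = argmin f a (List.map proj₂ D)

  -- A minimum never exceeds an average: `f (best f a D)` is the mean of a constant that is at most
  -- `f` on every outcome of `D`.
  best≤𝔼 : (f : A → ℚ) (a : A) {D : Dist A} → IsDist D → f (best f a D) ℚ.≤ 𝔼 D f
  best≤𝔼 f a {D} isD = subst (ℚ._≤ 𝔼 D f) (𝔼-const isD (f (best f a D)))
    (𝔼-mono-All D (proj₁ isD) (f[argmin]≤f[xs] a (List.map proj₂ D)))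

-- `S` does not depend on `b`. By this independence the two expectations commute, and a bound proved
-- for each fixed `b` may be averaged over `D`.
𝔼-average-bound : (S : Dist A) {D : Dist B} (c : ℚ) (f : A → ℚ) (g : A → B → ℚ) (h : B → ℚ) →
  IsDist D → (∀ b → c ℚ.+ 𝔼 S (λ a → f a ℚ.+ g a b) ℚ.≤ h b) →
  c ℚ.+ 𝔼 S (λ a → f a ℚ.+ 𝔼 D (g a)) ℚ.≤ 𝔼 D h
𝔼-average-bound S {D} c f g h isD bound = begin
  c ℚ.+ 𝔼 S (λ a → f a ℚ.+ 𝔼 D (g a))              ≡⟨ cong (c ℚ.+_) (𝔼-cong S λ a → 𝔼-const-+ isD (f a) (g a)) ⟨
  c ℚ.+ 𝔼 S (λ a → 𝔼 D (λ b → f a ℚ.+ g a b))      ≡⟨ cong (c ℚ.+_) (𝔼-swap S D _) ⟩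
  c ℚ.+ 𝔼 D (λ b → 𝔼 S (λ a → f a ℚ.+ g a b))      ≡⟨ 𝔼-const-+ isD c _ ⟨
  𝔼 D (λ b → c ℚ.+ 𝔼 S (λ a → f a ℚ.+ g a b))      ≤⟨ 𝔼-mono isD bound ⟩
  𝔼 D h                                            ∎
  where open ℚ.≤-Reasoning

-- The randomized algorithm

elements : Subset n → List (Fin n)
elements []            = []
elements (inside ∷ R)  = zero ∷ List.map suc (elements R)
elements (outside ∷ R) = List.map suc (elements R)

length-elements : (R : Subset n) → length (elements R) ≡ ∣ R ∣
length-elements []            = refl
length-elements (inside ∷ R)  = cong suc (trans (List.length-map suc (elements R)) (length-elements R))
length-elements (outside ∷ R) = trans (List.length-map suc (elements R)) (length-elements R)

minIn-lower : ∀ d (R : Subset n) f → All (λ x → minIn d R f ≤ f x) (elements R)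
minIn-lower d []            f = []
minIn-lower d (inside ∷ R)  f =
  m⊓n≤m _ _ ∷ All.map⁺ (All.map (≤-trans (m⊓n≤n (f zero) _)) (minIn-lower d R (f ∘ suc)))
minIn-lower d (outside ∷ R) f = All.map⁺ (minIn-lower d R (f ∘ suc))

minIn-attained : ∀ d (R : Subset n) f → minIn d R f ≡ d ⊎ Any (λ x → f x ≤ minIn d R f) (elements R)
minIn-attained d []            f = inj₁ refl
minIn-attained d (outside ∷ R) f with minIn-attained d R (f ∘ suc)
... | inj₁ eq = inj₁ eq
... | inj₂ at = inj₂ (Any.map⁺ at)
minIn-attained d (inside ∷ R)  f with ⊓-sel (f zero) (minIn d R (f ∘ suc))
... | inj₁ eq = inj₂ (here (≤-reflexive (sym eq)))
... | inj₂ eq with minIn-attained d R (f ∘ suc)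
...   | inj₁ eq′ = inj₁ (trans eq eq′)
...   | inj₂ at  = inj₂ (there (Any.map⁺ (Any.map (λ le → ≤-trans le (≤-reflexive (sym eq))) at)))

Nonempty⇒Any : (R : Subset n) {P : Fin n → Set} → Nonempty R → (∀ x → P x) → Any P (elements R)
Nonempty⇒Any (inside ∷ R)  ne              p = here (p zero)
Nonempty⇒Any (outside ∷ R) (suc x , there x∈R) p = Any.map⁺ (Nonempty⇒Any R (x , x∈R) (p ∘ suc))

access-attained : (τ : Permutation′ n) (R : Subset n) → Nonempty R →
                  Any (λ x → pos τ x ≤ access τ R) (elements R)
access-attained {n} τ R ne with minIn-attained n R (pos τ)
-- The default value in `access` is `n`, which no position exceeds; if it is returned, any element
-- of the nonempty `R` is a witness.
... | inj₁ eq = Nonempty⇒Any R ne (λ x → ≤-trans (pos≤n τ x) (≤-reflexive (sym eq)))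
... | inj₂ at = at

-- The truncation by the position is vacuous for elements of the request, where ℓ ≤ pos π x;
-- it makes this a probability for every x.
moveProbability : ℕ → Permutation′ n → Fin n → ℚ
moveProbability ℓ π x = ℤ.+ (ℓ ⊓ pos π x) ℚ./ pos π x

0≤moveProbability : ∀ ℓ (π : Permutation′ n) x → 0ℚ ℚ.≤ moveProbability ℓ π x
0≤moveProbability ℓ π x = 0≤/ (ℓ ⊓ pos π x) _

moveProbability≤1 : ∀ ℓ (π : Permutation′ n) x → moveProbability ℓ π x ℚ.≤ 1ℚ
moveProbability≤1 ℓ π x = /≤1 (ℓ ⊓ pos π x) _ (m⊓n≤n ℓ (pos π x))

tryMove : ℕ → Permutation′ n → Fin n → Dist (Permutation′ n)
tryMove ℓ π x = coin (moveProbability ℓ π x) (moveToFront x π) π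

stepAmong : ℕ → Permutation′ n → List (Fin n) → Dist (Permutation′ n)
stepAmong ℓ π []       = pure π
stepAmong ℓ π (x ∷ xs) = bind (uniform x xs) (tryMove ℓ π)

step : Subset n → Permutation′ n → Dist (Permutation′ n)
step R π = stepAmong (access π R) π (elements R)

IsDist-step : (R : Subset n) (π : Permutation′ n) → IsDist (step R π)
IsDist-step R π = among (elements R)
  where
  ℓ = access π R
  among : ∀ xs → IsDist (stepAmong ℓ π xs)
  among []       = IsDist-pure π
  among (x ∷ xs) = IsDist-bind (IsDist-uniform x xs)
    (λ z → IsDist-coin (0≤moveProbability ℓ π z) (moveProbability≤1 ℓ π z) (moveToFront z π) π)

-- The potential before the move is not subtracted here but stands on the right of the bounds, so
-- that only sums of naturals occur.
moveCost : ℕ → (π τ σ : Permutation′ n) → ℚ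
moveCost κ π τ σ = ℕtoℚ (dist π σ + Φ κ σ τ)

module _ (κ ℓ : ℕ) (π τ : Permutation′ n) (x : Fin n) (ℓ≤pos : ℓ ≤ pos π x) where

  private
    u F L P G O : ℚ
    u = moveProbability ℓ π x
    F = ℕtoℚ (Φ κ π τ)
    L = ℕtoℚ ℓ
    P = ℕtoℚ (pos π x)
    G = ℕtoℚ (κ * (pos π x ∸ κ * pos τ x))
    O = ℕtoℚ (κ * κ * pos τ x)
    expected moved : ℚ
    moved = moveCost κ π τ (moveToFront x π)
    expected = 𝔼 (tryMove ℓ π x) (moveCost κ π τ)

    uP≡L : u ℚ.* P ≡ L
    uP≡L = trans (/-*-cancel (ℓ ⊓ pos π x) _) (cong ℕtoℚ (m≤n⇒m⊓n≡m ℓ≤pos))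

    -- One `P` pays for the swaps, the other for the elements pushed back; `G` is the term of `x`
    -- that disappears.
    moved-bound : moved ℚ.+ G ℚ.≤ F ℚ.+ (P ℚ.+ P)
    moved-bound = begin
      moved ℚ.+ G                                            ≡⟨ ℕtoℚ-+ (d + f′) g ⟨
      ℕtoℚ (d + f′ + g)                                      ≤⟨ ℕtoℚ-mono {d + f′ + g} {Φ κ π τ + (p + p)} bound ⟩
      ℕtoℚ (Φ κ π τ + (p + p))                               ≡⟨ ℕtoℚ-+ (Φ κ π τ) (p + p) ⟩
      F ℚ.+ ℕtoℚ (p + p)                                     ≡⟨ cong (F ℚ.+_) (ℕtoℚ-+ p p) ⟩
      F ℚ.+ (P ℚ.+ P)                                        ∎
      where
      open ℚ.≤-Reasoning
      p = pos π x
      d = dist π (moveToFront x π)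
      f′ = Φ κ (moveToFront x π) τ
      g = κ * (p ∸ κ * pos τ x)
      bound : d + f′ + g ≤ Φ κ π τ + (p + p)
      bound = ℕ≤.begin
        d + f′ + g            ℕ≤.≡⟨ +-assoc d f′ g ⟩
        d + (f′ + g)          ℕ≤.≤⟨ +-mono-≤ (dist-moveToFront≤pos x π) (Φ-moveToFront κ x π τ) ⟩
        p + (Φ κ π τ + p)     ℕ≤.≡⟨ +-comm p _ ⟩
        Φ κ π τ + p + p       ℕ≤.≡⟨ +-assoc (Φ κ π τ) p p ⟩
        Φ κ π τ + (p + p)     ℕ≤.∎
        where module ℕ≤ = ≤-Reasoning

    -- Staying leaves the potential as it was, and the move has probability `u` with `u ℚ.* P` equal
    -- to `L`. So the expected expense is twice `ℓ`, however deep `x` lies.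
    expected-bound : expected ℚ.+ u ℚ.* G ℚ.≤ F ℚ.+ (L ℚ.+ L)
    expected-bound = begin
      expected ℚ.+ u ℚ.* G
        ≡⟨ cong (λ k → u ℚ.* moved ℚ.+ ((1ℚ ℚ.- u) ℚ.* ℕtoℚ (k + Φ κ π τ) ℚ.+ 0ℚ) ℚ.+ u ℚ.* G) (dist-refl π) ⟩
      u ℚ.* moved ℚ.+ ((1ℚ ℚ.- u) ℚ.* F ℚ.+ 0ℚ) ℚ.+ u ℚ.* G
        ≡⟨ solve 4 (λ u m f g → u :* m :+ ((con 1ℚ :- u) :* f :+ con 0ℚ) :+ u :* g
                             := u :* (m :+ g) :+ (con 1ℚ :- u) :* f) refl u moved F G ⟩
      u ℚ.* (moved ℚ.+ G) ℚ.+ (1ℚ ℚ.- u) ℚ.* F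
        ≤⟨ ℚ.+-monoˡ-≤ ((1ℚ ℚ.- u) ℚ.* F) (*-monoˡ (0≤moveProbability ℓ π x) moved-bound) ⟩
      u ℚ.* (F ℚ.+ (P ℚ.+ P)) ℚ.+ (1ℚ ℚ.- u) ℚ.* F
        ≡⟨ solve 3 (λ u f p → u :* (f :+ (p :+ p)) :+ (con 1ℚ :- u) :* f
                           := f :+ (u :* p :+ u :* p)) refl u F P ⟩
      F ℚ.+ (u ℚ.* P ℚ.+ u ℚ.* P)
        ≡⟨ cong (λ l → F ℚ.+ (l ℚ.+ l)) uP≡L ⟩
      F ℚ.+ (L ℚ.+ L) ∎
      where
      open ℚ.≤-Reasoning
      open +-*-Solver

  tryMove-cost : expected ℚ.≤ F ℚ.+ (L ℚ.+ L)
  tryMove-cost = ℚ.≤-trans (p≤p+q expected (0≤* (0≤moveProbability ℓ π x) (0≤ℕtoℚ (κ * (pos π x ∸ κ * pos τ x))))) expected-bound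

  -- Meant for the element that `τ` accesses. Since `u` times `κ * pos π x` is `κ * ℓ`, the
  -- vanishing term is worth `κ * ℓ` up to `O`, which is charged to `τ`. Where the subtraction in
  -- `G` truncates, `κ * pos π x` is at most `κ * κ * pos τ x` anyway.
  tryMove-gain : expected ℚ.+ ℕtoℚ (κ * ℓ) ℚ.≤ F ℚ.+ (L ℚ.+ L) ℚ.+ O
  tryMove-gain = begin
    expected ℚ.+ ℕtoℚ (κ * ℓ)                     ≤⟨ ℚ.+-monoʳ-≤ expected gain ⟩
    expected ℚ.+ (u ℚ.* G ℚ.+ O)                  ≡⟨ ℚ.+-assoc expected (u ℚ.* G) O ⟨
    expected ℚ.+ u ℚ.* G ℚ.+ O                    ≤⟨ ℚ.+-monoˡ-≤ O expected-bound ⟩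
    F ℚ.+ (L ℚ.+ L) ℚ.+ O                         ∎
    where
    open ℚ.≤-Reasoning
    open +-*-Solver
    K = ℕtoℚ κ
    κp≤ : κ * pos π x ≤ κ * (pos π x ∸ κ * pos τ x) + κ * κ * pos τ x
    κp≤ = ℕ≤.begin
      κ * pos π x                                              ℕ≤.≤⟨ *-monoʳ-≤ κ (m≤n+m∸n (pos π x) (κ * pos τ x)) ⟩
      κ * (κ * pos τ x + (pos π x ∸ κ * pos τ x))              ℕ≤.≡⟨ *-distribˡ-+ κ (κ * pos τ x) _ ⟩
      κ * (κ * pos τ x) + κ * (pos π x ∸ κ * pos τ x)          ℕ≤.≡⟨ +-comm (κ * (κ * pos τ x)) _ ⟩
      κ * (pos π x ∸ κ * pos τ x) + κ * (κ * pos τ x)          ℕ≤.≡⟨ cong (κ * (pos π x ∸ κ * pos τ x) +_) (*-assoc κ κ (pos τ x)) ⟨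
      κ * (pos π x ∸ κ * pos τ x) + κ * κ * pos τ x            ℕ≤.∎
      where module ℕ≤ = ≤-Reasoning
    gain : ℕtoℚ (κ * ℓ) ℚ.≤ u ℚ.* G ℚ.+ O
    gain = begin
      ℕtoℚ (κ * ℓ)                  ≡⟨ ℕtoℚ-* κ ℓ ⟩
      K ℚ.* L                       ≡⟨ cong (K ℚ.*_) uP≡L ⟨
      K ℚ.* (u ℚ.* P)               ≡⟨ solve 3 (λ k u p → k :* (u :* p) := u :* (k :* p)) refl K u P ⟩
      u ℚ.* (K ℚ.* P)               ≡⟨ cong (u ℚ.*_) (ℕtoℚ-* κ (pos π x)) ⟨
      u ℚ.* ℕtoℚ (κ * pos π x)      ≤⟨ *-monoˡ (0≤moveProbability ℓ π x) (ℕtoℚ-mono κp≤) ⟩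
      u ℚ.* ℕtoℚ (κ * (pos π x ∸ κ * pos τ x) + κ * κ * pos τ x)
                                    ≡⟨ cong (u ℚ.*_) (ℕtoℚ-+ (κ * (pos π x ∸ κ * pos τ x)) (κ * κ * pos τ x)) ⟩
      u ℚ.* (G ℚ.+ O)               ≡⟨ ℚ.*-distribˡ-+ u G O ⟩
      u ℚ.* G ℚ.+ u ℚ.* O           ≤⟨ ℚ.+-monoʳ-≤ (u ℚ.* G) (scale-≤ (moveProbability≤1 ℓ π x) (0≤ℕtoℚ (κ * κ * pos τ x))) ⟩
      u ℚ.* G ℚ.+ O                 ∎

-- Among `k` elements the good one is drawn with probability `1/k` and then saves `κ * ℓ`, in
-- expectation at least `3 * ℓ`. One `ℓ` pays for the access and two for the expense in
-- `tryMove-cost`; this is the origin of the factor 3.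
stepAmong-bound : ∀ κ ℓ o (π τ : Permutation′ n) xs → 3 * length xs ≤ κ →
  All (λ x → ℓ ≤ pos π x) xs → Any (λ x → pos τ x ≤ o) xs →
  ℕtoℚ ℓ ℚ.+ 𝔼 (stepAmong ℓ π xs) (moveCost κ π τ) ℚ.≤ ℕtoℚ (Φ κ π τ) ℚ.+ ℕtoℚ (κ * κ * o)
stepAmong-bound κ ℓ o π τ (x ∷ xs) 3k≤κ ℓ≤ o≥ = begin
  L ℚ.+ 𝔼 (bind (uniform x xs) (tryMove ℓ π)) (moveCost κ π τ)
    ≡⟨ cong (L ℚ.+_) (𝔼-bind (uniform x xs) (tryMove ℓ π) (moveCost κ π τ)) ⟩
  L ℚ.+ avg
    ≡⟨ solve 2 (λ l a → l :+ a := a :+ (l :+ (l :+ l)) :- (l :+ l)) refl L avg ⟩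
  avg ℚ.+ (L ℚ.+ (L ℚ.+ L)) ℚ.- (L ℚ.+ L)
    ≤⟨ ℚ.+-monoˡ-≤ (ℚ.- (L ℚ.+ L)) main ⟩
  F ℚ.+ (L ℚ.+ L) ℚ.+ O ℚ.- (L ℚ.+ L)
    ≡⟨ solve 3 (λ f l o → f :+ (l :+ l) :+ o :- (l :+ l) := f :+ o) refl F L O ⟩
  F ℚ.+ O ∎
  where
  open ℚ.≤-Reasoning
  open +-*-Solver
  L F O v avg : ℚ
  L = ℕtoℚ ℓ
  F = ℕtoℚ (Φ κ π τ)
  O = ℕtoℚ (κ * κ * o)
  k = suc (length xs)
  v = ℤ.+ 1 ℚ./ k
  avg = 𝔼 (uniform x xs) (λ z → 𝔼 (tryMove ℓ π z) (moveCost κ π τ))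
  k·3ℓ≤κℓ : k * (ℓ + (ℓ + ℓ)) ≤ κ * ℓ
  k·3ℓ≤κℓ = ℕ≤.begin
    k * (ℓ + (ℓ + ℓ))   ℕ≤.≡⟨ cong (λ m → k * (ℓ + (ℓ + m))) (+-identityʳ ℓ) ⟨
    k * (3 * ℓ)         ℕ≤.≡⟨ *-assoc k 3 ℓ ⟨
    k * 3 * ℓ           ℕ≤.≡⟨ cong (_* ℓ) (*-comm k 3) ⟩
    3 * k * ℓ           ℕ≤.≤⟨ *-monoˡ-≤ ℓ 3k≤κ ⟩
    κ * ℓ               ℕ≤.∎
    where module ℕ≤ = ≤-Reasoning
  3L≤ : L ℚ.+ (L ℚ.+ L) ℚ.≤ v ℚ.* ℕtoℚ (κ * ℓ)
  3L≤ = begin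
    L ℚ.+ (L ℚ.+ L)                            ≡⟨ cong (L ℚ.+_) (ℕtoℚ-+ ℓ ℓ) ⟨
    L ℚ.+ ℕtoℚ (ℓ + ℓ)                         ≡⟨ ℕtoℚ-+ ℓ (ℓ + ℓ) ⟨
    ℕtoℚ (ℓ + (ℓ + ℓ))                         ≡⟨ ℚ.*-identityˡ (ℕtoℚ (ℓ + (ℓ + ℓ))) ⟨
    1ℚ ℚ.* ℕtoℚ (ℓ + (ℓ + ℓ))                  ≡⟨ cong (ℚ._* ℕtoℚ (ℓ + (ℓ + ℓ))) (/-*-cancel 1 (length xs)) ⟨
    v ℚ.* ℕtoℚ k ℚ.* ℕtoℚ (ℓ + (ℓ + ℓ))        ≡⟨ ℚ.*-assoc v (ℕtoℚ k) (ℕtoℚ (ℓ + (ℓ + ℓ))) ⟩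
    v ℚ.* (ℕtoℚ k ℚ.* ℕtoℚ (ℓ + (ℓ + ℓ)))      ≡⟨ cong (v ℚ.*_) (ℕtoℚ-* k (ℓ + (ℓ + ℓ))) ⟨
    v ℚ.* ℕtoℚ (k * (ℓ + (ℓ + ℓ)))             ≤⟨ *-monoˡ (0≤/ 1 (length xs)) (ℕtoℚ-mono k·3ℓ≤κℓ) ⟩
    v ℚ.* ℕtoℚ (κ * ℓ)                         ∎
  gains : ∀ {ys} → All (λ x → ℓ ≤ pos π x) ys → Any (λ x → pos τ x ≤ o) ys →
          Any (λ z → 𝔼 (tryMove ℓ π z) (moveCost κ π τ) ℚ.+ ℕtoℚ (κ * ℓ) ℚ.≤ F ℚ.+ (L ℚ.+ L) ℚ.+ O) ys
  gains {z ∷ _} (ℓ≤ ∷ _) (here le) = here (ℚ.≤-trans (tryMove-gain κ ℓ π τ z ℓ≤)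
    (ℚ.+-monoʳ-≤ (F ℚ.+ (L ℚ.+ L)) (ℕtoℚ-mono (*-monoʳ-≤ (κ * κ) le))))
  gains (_ ∷ ℓ≤) (there at) = there (gains ℓ≤ at)
  main : avg ℚ.+ (L ℚ.+ (L ℚ.+ L)) ℚ.≤ F ℚ.+ (L ℚ.+ L) ℚ.+ O
  main = begin
    avg ℚ.+ (L ℚ.+ (L ℚ.+ L))               ≤⟨ ℚ.+-monoʳ-≤ avg 3L≤ ⟩
    avg ℚ.+ v ℚ.* ℕtoℚ (κ * ℓ)              ≤⟨ 𝔼-uniform-slack x xs (All.map (λ {z} → tryMove-cost κ ℓ π τ z) ℓ≤) (gains ℓ≤ o≥) ⟩
    F ℚ.+ (L ℚ.+ L) ℚ.+ v ℚ.* O             ≤⟨ ℚ.+-monoʳ-≤ (F ℚ.+ (L ℚ.+ L)) (scale-≤ (/≤1 1 (length xs) (s≤s z≤n)) (0≤ℕtoℚ (κ * κ * o))) ⟩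
    F ℚ.+ (L ℚ.+ L) ℚ.+ O                   ∎

-- Phrased with `κ` instead of `r`, because the deterministic algorithm relies on it at its current
-- `κ`.
Admissible : ℕ → Subset n → Set
Admissible κ R = Nonempty R × 3 * ∣ R ∣ ≤ κ

-- First `π` answers while the reference list is still `τ`; then `τ` becomes `τ′`, which `Φ-reorder`
-- bounds for whatever `σ` was drawn.
step-bound : ∀ κ (R : Subset n) → Admissible κ R → (π τ τ′ : Permutation′ n) →
  ℕtoℚ (access π R) ℚ.+ 𝔼 (step R π) (moveCost κ π τ′) ℚ.≤
  ℕtoℚ (Φ κ π τ + κ * κ * (access τ R + dist τ τ′))
step-bound κ R (ne , 3R≤κ) π τ τ′ = begin
  Acc ℚ.+ 𝔼 (step R π) (moveCost κ π τ′)
    ≤⟨ ℚ.+-monoʳ-≤ Acc (𝔼-mono (IsDist-step R π) reorder) ⟩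
  Acc ℚ.+ 𝔼 (step R π) (λ σ → D ℚ.+ moveCost κ π τ σ)
    ≡⟨ cong (Acc ℚ.+_) (𝔼-const-+ (IsDist-step R π) D (moveCost κ π τ)) ⟩
  Acc ℚ.+ (D ℚ.+ E)
    ≡⟨ solve 3 (λ a d e → a :+ (d :+ e) := a :+ e :+ d) refl Acc D E ⟩
  Acc ℚ.+ E ℚ.+ D
    ≤⟨ ℚ.+-monoˡ-≤ D (stepAmong-bound κ (access π R) (access τ R) π τ (elements R)
         (subst (λ k → 3 * k ≤ κ) (sym (length-elements R)) 3R≤κ)
         (minIn-lower _ R (pos π)) (access-attained τ R ne)) ⟩
  ℕtoℚ (Φ κ π τ) ℚ.+ ℕtoℚ (κ * κ * access τ R) ℚ.+ D
    ≡⟨ cong (ℚ._+ D) (ℕtoℚ-+ (Φ κ π τ) (κ * κ * access τ R)) ⟨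
  ℕtoℚ (Φ κ π τ + κ * κ * access τ R) ℚ.+ D
    ≡⟨ ℕtoℚ-+ (Φ κ π τ + κ * κ * access τ R) (κ * κ * dist τ τ′) ⟨
  ℕtoℚ (Φ κ π τ + κ * κ * access τ R + κ * κ * dist τ τ′)
    ≡⟨ cong ℕtoℚ (trans (+-assoc (Φ κ π τ) _ _) (cong (Φ κ π τ +_) (sym (*-distribˡ-+ (κ * κ) (access τ R) (dist τ τ′))))) ⟩
  ℕtoℚ (Φ κ π τ + κ * κ * (access τ R + dist τ τ′)) ∎
  where
  open ℚ.≤-Reasoning
  open +-*-Solver
  Acc D E : ℚ
  Acc = ℕtoℚ (access π R)
  D = ℕtoℚ (κ * κ * dist τ τ′)
  E = 𝔼 (step R π) (moveCost κ π τ)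
  reorder : ∀ σ → moveCost κ π τ′ σ ℚ.≤ D ℚ.+ moveCost κ π τ σ
  reorder σ = begin
    ℕtoℚ (dist π σ + Φ κ σ τ′)                              ≤⟨ ℕtoℚ-mono (+-monoʳ-≤ (dist π σ) (Φ-reorder κ σ τ τ′)) ⟩
    ℕtoℚ (dist π σ + (Φ κ σ τ + κ * κ * dist τ τ′))         ≡⟨ cong ℕtoℚ (trans (sym (+-assoc (dist π σ) _ _)) (+-comm _ (κ * κ * dist τ τ′))) ⟩
    ℕtoℚ (κ * κ * dist τ τ′ + (dist π σ + Φ κ σ τ))         ≡⟨ ℕtoℚ-+ (κ * κ * dist τ τ′) (dist π σ + Φ κ σ τ) ⟩
    D ℚ.+ moveCost κ π τ σ                                  ∎

-- Total expected cost

current : Permutation′ n → List (Subset n × Permutation′ n) → Permutation′ n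
current π₀ []             = π₀
current π₀ ((_ , σ) ∷ _)  = σ

randAlg : RandAlg
randAlg = record
  { choose = λ π₀ hist R → step R (current π₀ hist)
  ; valid  = λ π₀ hist R → IsDist-step R (current π₀ hist)
  }

-- `randAlg` depends on the past only through its current list. Dropping the history makes the
-- starting list a variable, over which the deterministic analysis averages.
rcost : Permutation′ n → List (Subset n) → ℚ
rcost π []       = 0ℚ
rcost π (R ∷ Rs) = ℕtoℚ (access π R) ℚ.+ 𝔼 (step R π) (λ σ → ℕtoℚ (dist π σ) ℚ.+ rcost σ Rs)

-- The local function avg of expCostFrom cannot be named from outside; the underscore in the type of
-- avg≡𝔼 is solved to it by the use in expCostFrom-∷.
mutual
  expCostFrom-∷ : (A : RandAlg) (π₀ : Permutation′ n) (hist : List (Subset n × Permutation′ n))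
    (π : Permutation′ n) (R : Subset n) (Rs : List (Subset n)) →
    expCostFrom A π₀ hist π (R ∷ Rs) ≡
    ℕtoℚ (access π R) ℚ.+ 𝔼 (RandAlg.choose A π₀ hist R)
      (λ σ → ℕtoℚ (dist π σ) ℚ.+ expCostFrom A π₀ ((R , σ) ∷ hist) σ Rs)
  expCostFrom-∷ A π₀ hist π R Rs with RandAlg.choose A π₀ hist R
  ... | D = cong (ℕtoℚ (access π R) ℚ.+_) (avg≡𝔼 A π₀ hist π R Rs D)

  avg≡𝔼 : (A : RandAlg) (π₀ : Permutation′ n) (hist : List (Subset n × Permutation′ n))
    (π : Permutation′ n) (R : Subset n) (Rs : List (Subset n)) (D : Dist (Permutation′ n)) →
    _ ≡ 𝔼 D (λ σ → ℕtoℚ (dist π σ) ℚ.+ expCostFrom A π₀ ((R , σ) ∷ hist) σ Rs)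
  avg≡𝔼 A π₀ hist π R Rs []             = refl
  avg≡𝔼 A π₀ hist π R Rs ((p , σ) ∷ ps) =
    cong (p ℚ.* (ℕtoℚ (dist π σ) ℚ.+ expCostFrom A π₀ ((R , σ) ∷ hist) σ Rs) ℚ.+_) (avg≡𝔼 A π₀ hist π R Rs ps)

expCostFrom≡rcost : (π₀ : Permutation′ n) (hist : List (Subset n × Permutation′ n)) (Rs : List (Subset n)) →
  expCostFrom randAlg π₀ hist (current π₀ hist) Rs ≡ rcost (current π₀ hist) Rs
expCostFrom≡rcost π₀ hist []       = refl
expCostFrom≡rcost π₀ hist (R ∷ Rs) = trans (expCostFrom-∷ randAlg π₀ hist π R Rs)
  (cong (ℕtoℚ (access π R) ℚ.+_) (𝔼-cong (step R π) λ σ →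
    cong (ℕtoℚ (dist π σ) ℚ.+_) (expCostFrom≡rcost π₀ ((R , σ) ∷ hist) Rs)))
  where π = current π₀ hist

-- `step-bound` telescopes along the offline lists: the potential after one step is the one from
-- which the next step starts.
rcost-bound : ∀ κ (π τ : Permutation′ n) σ Rs → All (Admissible κ) Rs →
              rcost π Rs ℚ.≤ ℕtoℚ (κ * κ * offCost τ σ Rs + Φ κ π τ)
rcost-bound κ π τ σ []       []       = 0≤ℕtoℚ (κ * κ * 0 + Φ κ π τ)
rcost-bound κ π τ σ (R ∷ Rs) (ok ∷ oks) = begin
  Acc ℚ.+ 𝔼 (step R π) (λ π′ → ℕtoℚ (dist π π′) ℚ.+ rcost π′ Rs)
    ≤⟨ ℚ.+-monoʳ-≤ Acc (𝔼-mono (IsDist-step R π) later) ⟩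
  Acc ℚ.+ 𝔼 (step R π) (λ π′ → ℕtoℚ rest ℚ.+ moveCost κ π τ′ π′)
    ≡⟨ cong (Acc ℚ.+_) (𝔼-const-+ (IsDist-step R π) (ℕtoℚ rest) (moveCost κ π τ′)) ⟩
  Acc ℚ.+ (ℕtoℚ rest ℚ.+ E)
    ≡⟨ solve 3 (λ a r e → a :+ (r :+ e) := r :+ (a :+ e)) refl Acc (ℕtoℚ rest) E ⟩
  ℕtoℚ rest ℚ.+ (Acc ℚ.+ E)
    ≤⟨ ℚ.+-monoʳ-≤ (ℕtoℚ rest) (step-bound κ R ok π τ τ′) ⟩
  ℕtoℚ rest ℚ.+ ℕtoℚ (Φ κ π τ + κ * κ * (access τ R + dist τ τ′))
    ≡⟨ ℕtoℚ-+ rest (Φ κ π τ + κ * κ * (access τ R + dist τ τ′)) ⟨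
  ℕtoℚ (rest + (Φ κ π τ + κ * κ * (access τ R + dist τ τ′)))
    ≡⟨ cong ℕtoℚ (ℕ-Solver.solve 4 (λ k o f a → k ℕ-Solver.:* o ℕ-Solver.:+ (f ℕ-Solver.:+ k ℕ-Solver.:* a)
                     ℕ-Solver.:= k ℕ-Solver.:* (a ℕ-Solver.:+ o) ℕ-Solver.:+ f) refl
                   (κ * κ) off (Φ κ π τ) (access τ R + dist τ τ′)) ⟩
  ℕtoℚ (κ * κ * (access τ R + dist τ τ′ + off) + Φ κ π τ) ∎
  where
  open ℚ.≤-Reasoning
  open +-*-Solver
  τ′ = σ 0
  off = offCost τ′ (σ ∘ suc) Rs
  rest = κ * κ * off
  Acc E : ℚ
  Acc = ℕtoℚ (access π R)
  E = 𝔼 (step R π) (moveCost κ π τ′)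
  later : ∀ π′ → ℕtoℚ (dist π π′) ℚ.+ rcost π′ Rs ℚ.≤ ℕtoℚ rest ℚ.+ moveCost κ π τ′ π′
  later π′ = begin
    ℕtoℚ d ℚ.+ rcost π′ Rs                   ≤⟨ ℚ.+-monoʳ-≤ (ℕtoℚ d) (rcost-bound κ π′ τ′ (σ ∘ suc) Rs oks) ⟩
    ℕtoℚ d ℚ.+ ℕtoℚ (rest + f)               ≡⟨ ℕtoℚ-+ d (rest + f) ⟨
    ℕtoℚ (d + (rest + f))                    ≡⟨ cong ℕtoℚ (trans (sym (+-assoc d rest f)) (trans (cong (_+ f) (+-comm d rest)) (+-assoc rest d f))) ⟩
    ℕtoℚ (rest + (d + f))                    ≡⟨ ℕtoℚ-+ rest (d + f) ⟩
    ℕtoℚ rest ℚ.+ moveCost κ π τ′ π′         ∎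
    where
    d = dist π π′
    f = Φ κ π′ τ′

-- The deterministic algorithm

-- `own` is the list actually kept, `sim` the exact distribution of the list of `randAlg` on the
-- same requests, and `κ` three times the largest request so far.
record State (n : ℕ) : Set where
  field
    κ   : ℕ
    own : Permutation′ n
    sim : Dist (Permutation′ n)

open State

𝔼Φ : ℕ → Permutation′ n → Dist (Permutation′ n) → ℚ
𝔼Φ κ π μ = 𝔼 μ (λ τ → ℕtoℚ (Φ κ π τ))

score : ℕ → Permutation′ n → Dist (Permutation′ n) → Permutation′ n → ℚ
score κ π μ σ = ℕtoℚ (dist π σ) ℚ.+ 𝔼Φ κ σ μ

-- `κ` and `sim` are updated first, so the move is scored against the simulation after `R`. The
-- candidates are `own` and the outcomes of the randomized step from it, which is what the averaging
-- needs.
advance : Subset n → State n → State n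
advance R s = record
  { κ   = κ′
  ; own = best (score κ′ (own s) sim′) (own s) (step R (own s))
  ; sim = sim′
  }
  where
  κ′ = κ s ⊔ 3 * ∣ R ∣
  sim′ = bind (sim s) (step R)

run : Permutation′ n → List (Subset n) → State n
run π₀ []         = record { κ = 0 ; own = π₀ ; sim = pure π₀ }
run π₀ (R ∷ hist) = advance R (run π₀ hist)

detAlg : DetAlg
detAlg π₀ hist = own (run π₀ hist)

IsDist-sim : (π₀ : Permutation′ n) (hist : List (Subset n)) → IsDist (sim (run π₀ hist))
IsDist-sim π₀ []         = IsDist-pure π₀
IsDist-sim π₀ (R ∷ hist) = IsDist-bind (IsDist-sim π₀ hist) (IsDist-step R)

-- The right side of `step-bound` with a free coefficient `c`. It becomes `K * K` for a final bound
-- `K`, so that all requests share one coefficient while `κ` grows.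
simMove : ℚ → ℕ → Subset n → (π τ τ′ : Permutation′ n) → ℚ
simMove c κ R π τ τ′ = ℕtoℚ (Φ κ π τ) ℚ.+ c ℚ.* (ℕtoℚ (access τ R) ℚ.+ ℕtoℚ (dist τ τ′))

𝔼simMove : ℚ → ℕ → Subset n → Permutation′ n → Dist (Permutation′ n) → ℚ
𝔼simMove c κ R π μ = 𝔼 μ (λ τ → 𝔼 (step R τ) (simMove c κ R π τ))

simMove-bound : ∀ K (R : Subset n) κ → Admissible κ R → κ ≤ K → (π τ τ′ : Permutation′ n) →
  ℕtoℚ (access π R) ℚ.+ 𝔼 (step R π) (λ σ → ℕtoℚ (dist π σ) ℚ.+ ℕtoℚ (Φ κ σ τ′)) ℚ.≤
  simMove (ℕtoℚ (K * K)) κ R π τ τ′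
simMove-bound K R κ ok κ≤K π τ τ′ = begin
  ℕtoℚ (access π R) ℚ.+ 𝔼 (step R π) (λ σ → ℕtoℚ (dist π σ) ℚ.+ ℕtoℚ (Φ κ σ τ′))
    ≡⟨ cong (ℕtoℚ (access π R) ℚ.+_) (𝔼-cong (step R π) λ σ → ℕtoℚ-+ (dist π σ) (Φ κ σ τ′)) ⟨
  ℕtoℚ (access π R) ℚ.+ 𝔼 (step R π) (moveCost κ π τ′)
    ≤⟨ step-bound κ R ok π τ τ′ ⟩
  ℕtoℚ (Φ κ π τ + κ * κ * (access τ R + dist τ τ′))
    ≤⟨ ℕtoℚ-mono (+-monoʳ-≤ (Φ κ π τ) (*-monoˡ-≤ (access τ R + dist τ τ′) (*-mono-≤ κ≤K κ≤K))) ⟩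
  ℕtoℚ (Φ κ π τ + K * K * (access τ R + dist τ τ′))
    ≡⟨ ℕtoℚ-+ (Φ κ π τ) (K * K * (access τ R + dist τ τ′)) ⟩
  ℕtoℚ (Φ κ π τ) ℚ.+ ℕtoℚ (K * K * (access τ R + dist τ τ′))
    ≡⟨ cong (ℕtoℚ (Φ κ π τ) ℚ.+_) (ℕtoℚ-* (K * K) (access τ R + dist τ τ′)) ⟩
  ℕtoℚ (Φ κ π τ) ℚ.+ ℕtoℚ (K * K) ℚ.* ℕtoℚ (access τ R + dist τ τ′)
    ≡⟨ cong (λ q → ℕtoℚ (Φ κ π τ) ℚ.+ ℕtoℚ (K * K) ℚ.* q) (ℕtoℚ-+ (access τ R) (dist τ τ′)) ⟩
  simMove (ℕtoℚ (K * K)) κ R π τ τ′ ∎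
  where open ℚ.≤-Reasoning

𝔼score-bound : ∀ K (R : Subset n) κ → Admissible κ R → κ ≤ K → (π : Permutation′ n) (μ : Dist (Permutation′ n)) → IsDist μ →
  ℕtoℚ (access π R) ℚ.+ 𝔼 (step R π) (score κ π (bind μ (step R))) ℚ.≤ 𝔼simMove (ℕtoℚ (K * K)) κ R π μ
𝔼score-bound K R κ ok κ≤K π μ isμ = begin
  ℕtoℚ (access π R) ℚ.+ 𝔼 (step R π) (score κ π (bind μ (step R)))
    ≡⟨ cong (ℕtoℚ (access π R) ℚ.+_) (𝔼-cong (step R π) λ σ → cong (ℕtoℚ (dist π σ) ℚ.+_)
         (𝔼-bind μ (step R) (λ τ′ → ℕtoℚ (Φ κ σ τ′)))) ⟩
  ℕtoℚ (access π R) ℚ.+ 𝔼 (step R π) (λ σ → ℕtoℚ (dist π σ) ℚ.+ 𝔼 μ (λ τ → 𝔼 (step R τ) (λ τ′ → ℕtoℚ (Φ κ σ τ′))))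
    -- The inner average is over the next list `τ′` drawn from `τ`, the outer one over `τ` itself;
    -- the randomized move from `π` is independent of both.
    ≤⟨ 𝔼-average-bound (step R π) (ℕtoℚ (access π R)) (λ σ → ℕtoℚ (dist π σ))
         (λ σ τ → 𝔼 (step R τ) (λ τ′ → ℕtoℚ (Φ κ σ τ′))) (λ τ → 𝔼 (step R τ) (simMove (ℕtoℚ (K * K)) κ R π τ)) isμ (λ τ →
         𝔼-average-bound (step R π) (ℕtoℚ (access π R)) (λ σ → ℕtoℚ (dist π σ))
           (λ σ τ′ → ℕtoℚ (Φ κ σ τ′)) (simMove (ℕtoℚ (K * K)) κ R π τ) (IsDist-step R τ) (simMove-bound K R κ ok κ≤K π τ)) ⟩
  𝔼simMove (ℕtoℚ (K * K)) κ R π μ ∎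
  where open ℚ.≤-Reasoning

-- The deterministic list moves at least as well as a randomized move independent of the simulation,
-- and step-bound holds for the latter against every pair (τ, τ′) of consecutive simulated lists.
greedy-bound : ∀ K (R : Subset n) (s : State n) → let s′ = advance R s in
  IsDist (sim s) → Admissible (κ s′) R → κ s′ ≤ K →
  ℕtoℚ (access (own s) R) ℚ.+ score (κ s′) (own s) (sim s′) (own s′) ℚ.≤ 𝔼simMove (ℕtoℚ (K * K)) (κ s′) R (own s) (sim s)
greedy-bound K R s isμ ok κ′≤K = ℚ.≤-trans
  (ℚ.+-monoʳ-≤ (ℕtoℚ (access (own s) R))
    (best≤𝔼 (score (κ (advance R s)) (own s) (sim (advance R s))) (own s) (IsDist-step R (own s))))
  (𝔼score-bound K R (κ (advance R s)) ok κ′≤K (own s) (sim s) isμ)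

-- By linearity, `𝔼simMove` supplies the current request and the distribution after the step all
-- later ones. The potential passes through, as it does not involve `τ′`.
simCost-∷ : ∀ (c : ℚ) κ (R : Subset n) (π : Permutation′ n) μ Rs →
  𝔼simMove c κ R π μ ℚ.+ c ℚ.* 𝔼 (bind μ (step R)) (λ τ′ → rcost τ′ Rs)
  ≡ c ℚ.* 𝔼 μ (λ τ → rcost τ (R ∷ Rs)) ℚ.+ 𝔼Φ κ π μ
simCost-∷ c κ R π μ Rs = begin
  𝔼simMove c κ R π μ ℚ.+ c ℚ.* 𝔼 (bind μ (step R)) (λ τ′ → rcost τ′ Rs)
    ≡⟨ cong₂ ℚ._+_ (𝔼-cong μ split) (cong (c ℚ.*_) (𝔼-bind μ (step R) (λ τ′ → rcost τ′ Rs))) ⟩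
  𝔼 μ (λ τ → f τ ℚ.+ c ℚ.* moved τ) ℚ.+ c ℚ.* 𝔼 μ future
    ≡⟨ cong₂ ℚ._+_ (trans (𝔼-+ μ f (λ τ → c ℚ.* moved τ)) (cong (𝔼 μ f ℚ.+_) (𝔼-* μ c moved))) refl ⟩
  𝔼 μ f ℚ.+ c ℚ.* 𝔼 μ moved ℚ.+ c ℚ.* 𝔼 μ future
    ≡⟨ solve 4 (λ f c m r → f :+ c :* m :+ c :* r := c :* (m :+ r) :+ f) refl (𝔼 μ f) c (𝔼 μ moved) (𝔼 μ future) ⟩
  c ℚ.* (𝔼 μ moved ℚ.+ 𝔼 μ future) ℚ.+ 𝔼 μ f
    ≡⟨ cong (λ q → c ℚ.* q ℚ.+ 𝔼 μ f) (𝔼-+ μ moved future) ⟨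
  c ℚ.* 𝔼 μ (λ τ → moved τ ℚ.+ future τ) ℚ.+ 𝔼 μ f
    ≡⟨ cong (λ q → c ℚ.* q ℚ.+ 𝔼 μ f) (𝔼-cong μ join) ⟩
  c ℚ.* 𝔼 μ (λ τ → rcost τ (R ∷ Rs)) ℚ.+ 𝔼 μ f ∎
  where
  open ≡-Reasoning
  open +-*-Solver
  f a moved future : Permutation′ _ → ℚ
  f τ = ℕtoℚ (Φ κ π τ)
  a τ = ℕtoℚ (access τ R)
  moved τ = a τ ℚ.+ 𝔼 (step R τ) (λ τ′ → ℕtoℚ (dist τ τ′))
  future τ = 𝔼 (step R τ) (λ τ′ → rcost τ′ Rs)
  split : ∀ τ → 𝔼 (step R τ) (simMove c κ R π τ) ≡ f τ ℚ.+ c ℚ.* moved τ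
  split τ = trans (𝔼-const-+ (IsDist-step R τ) (f τ) (λ τ′ → c ℚ.* (a τ ℚ.+ ℕtoℚ (dist τ τ′))))
    (cong (f τ ℚ.+_) (trans (𝔼-* (step R τ) c (λ τ′ → a τ ℚ.+ ℕtoℚ (dist τ τ′)))
      (cong (c ℚ.*_) (𝔼-const-+ (IsDist-step R τ) (a τ) (λ τ′ → ℕtoℚ (dist τ τ′))))))
  join : ∀ τ → moved τ ℚ.+ future τ ≡ rcost τ (R ∷ Rs)
  join τ = trans (ℚ.+-assoc (a τ) (𝔼 (step R τ) (λ τ′ → ℕtoℚ (dist τ τ′))) (future τ))
    (cong (a τ ℚ.+_) (sym (𝔼-+ (step R τ) (λ τ′ → ℕtoℚ (dist τ τ′)) (λ τ′ → rcost τ′ Rs))))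

-- Growing `κ` and the cost budget

maxΦ : ℕ → ℕ → ℕ
maxΦ n K = n * (K * n)

Φ≤maxΦ : ∀ {κ K} → κ ≤ K → (π τ : Permutation′ n) → Φ κ π τ ≤ maxΦ n K
Φ≤maxΦ {n} {κ} κ≤K π τ = ≤-trans (Φ-bound κ π τ) (*-monoʳ-≤ n (*-monoˡ-≤ n κ≤K))

-- Raising κ may change the potential arbitrarily; the reserve pays maxΦ for each such event.
reserve : ℕ → ℕ → ℕ → ℕ
reserve n K κ = (K ∸ κ) * maxΦ n K

-- If `m ≤ κ`, nothing changes. Otherwise `κ` grows strictly, so `K ∸ κ` falls by at least one and
-- releases a whole `maxΦ n K`, enough for the new potential against any list.
raise-κ : ∀ K κ m (π : Permutation′ n) μ → IsDist μ → κ ⊔ m ≤ K →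
  𝔼Φ (κ ⊔ m) π μ ℚ.+ ℕtoℚ (reserve n K (κ ⊔ m)) ℚ.≤ 𝔼Φ κ π μ ℚ.+ ℕtoℚ (reserve n K κ)
raise-κ {n} K κ m π μ isμ κ⊔m≤K with ≤-<-connex m κ
... | inj₁ m≤κ rewrite m≥n⇒m⊔n≡m m≤κ = ℚ.≤-refl
... | inj₂ κ<m = begin
  𝔼Φ κ′ π μ ℚ.+ ℕtoℚ (reserve n K κ′)
    ≤⟨ ℚ.+-monoˡ-≤ (ℕtoℚ (reserve n K κ′)) (ℚ.≤-trans
         (𝔼-mono isμ (λ τ → ℕtoℚ-mono (Φ≤maxΦ κ⊔m≤K π τ)))
         (ℚ.≤-reflexive (𝔼-const isμ (ℕtoℚ (maxΦ n K))))) ⟩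
  ℕtoℚ (maxΦ n K) ℚ.+ ℕtoℚ (reserve n K κ′)
    ≡⟨ ℕtoℚ-+ (maxΦ n K) (reserve n K κ′) ⟨
  ℕtoℚ (suc (K ∸ κ′) * maxΦ n K)
    ≤⟨ ℕtoℚ-mono (*-monoˡ-≤ (maxΦ n K) (∸-monoʳ-< (≤-trans κ<m (m≤n⊔m κ m)) κ⊔m≤K)) ⟩
  ℕtoℚ (reserve n K κ)
    ≡⟨ ℚ.+-identityˡ (ℕtoℚ (reserve n K κ)) ⟨
  0ℚ ℚ.+ ℕtoℚ (reserve n K κ)
    ≤⟨ ℚ.+-monoˡ-≤ (ℕtoℚ (reserve n K κ)) (𝔼-nonneg isμ (λ τ → 0≤ℕtoℚ (Φ κ π τ))) ⟩
  𝔼Φ κ π μ ℚ.+ ℕtoℚ (reserve n K κ) ∎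
  where
  open ℚ.≤-Reasoning
  κ′ = κ ⊔ m

-- `A` and `D` are the access and move costs; `Y` and `X` the weighted remaining cost of the
-- simulation before and after the request; `F`, `F′`, `Ψ` the potential at first, after raising
-- `κ`, and after the move; `M` and `M′` the reserves.
balance : ∀ {A D rest X Ψ M′ H Y F′ F M} → rest ℚ.≤ X ℚ.+ (Ψ ℚ.+ M′) → A ℚ.+ (D ℚ.+ Ψ) ℚ.≤ H →
          H ℚ.+ X ≡ Y ℚ.+ F′ → F′ ℚ.+ M′ ℚ.≤ F ℚ.+ M → A ℚ.+ D ℚ.+ rest ℚ.≤ Y ℚ.+ (F ℚ.+ M)
balance {A} {D} {rest} {X} {Ψ} {M′} {H} {Y} {F′} {F} {M} future move sim reserves = begin
  A ℚ.+ D ℚ.+ rest                       ≤⟨ ℚ.+-monoʳ-≤ (A ℚ.+ D) future ⟩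
  A ℚ.+ D ℚ.+ (X ℚ.+ (Ψ ℚ.+ M′))         ≡⟨ solve 5 (λ a d x p m → a :+ d :+ (x :+ (p :+ m)) := a :+ (d :+ p) :+ x :+ m) refl A D X Ψ M′ ⟩
  A ℚ.+ (D ℚ.+ Ψ) ℚ.+ X ℚ.+ M′           ≤⟨ ℚ.+-monoˡ-≤ M′ (ℚ.+-monoˡ-≤ X move) ⟩
  H ℚ.+ X ℚ.+ M′                         ≡⟨ cong (ℚ._+ M′) sim ⟩
  Y ℚ.+ F′ ℚ.+ M′                        ≡⟨ ℚ.+-assoc Y F′ M′ ⟩
  Y ℚ.+ (F′ ℚ.+ M′)                      ≤⟨ ℚ.+-monoʳ-≤ Y reserves ⟩
  Y ℚ.+ (F ℚ.+ M)                        ∎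
  where
  open ℚ.≤-Reasoning
  open +-*-Solver

opaque
  -- The invariant of the induction: an upper bound on all that the deterministic algorithm will pay
  -- on `Rs`.
  budget : ℕ → State n → List (Subset n) → ℚ
  budget {n} K s Rs =
    ℕtoℚ (K * K) ℚ.* 𝔼 (sim s) (λ τ → rcost τ Rs) ℚ.+ (𝔼Φ (κ s) (own s) (sim s) ℚ.+ ℕtoℚ (reserve n K (κ s)))

  0≤budget : ∀ K (s : State n) → IsDist (sim s) → 0ℚ ℚ.≤ budget K s []
  0≤budget {n} K s isμ = ℚ.+-mono-≤
    (0≤* (0≤ℕtoℚ (K * K)) (𝔼-nonneg isμ (λ _ → ℚ.≤-refl)))
    (ℚ.+-mono-≤ (𝔼-nonneg isμ (λ τ → 0≤ℕtoℚ (Φ (κ s) (own s) τ))) (0≤ℕtoℚ (reserve n K (κ s))))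

  budget-advance : ∀ K (s : State n) R Rs {rest} → IsDist (sim s) → Admissible (κ (advance R s)) R → κ (advance R s) ≤ K →
    rest ℚ.≤ budget K (advance R s) Rs →
    ℕtoℚ (access (own s) R) ℚ.+ ℕtoℚ (dist (own s) (own (advance R s))) ℚ.+ rest ℚ.≤ budget K s (R ∷ Rs)
  budget-advance {n} K s R Rs {rest} isμ ok κ′≤K future = balance
    {A = ℕtoℚ (access (own s) R)} {D = ℕtoℚ (dist (own s) (own (advance R s)))} {rest = rest}
    {X = ℕtoℚ (K * K) ℚ.* 𝔼 (sim (advance R s)) (λ τ → rcost τ Rs)}
    {Ψ = 𝔼Φ (κ (advance R s)) (own (advance R s)) (sim (advance R s))}
    {M′ = ℕtoℚ (reserve n K (κ (advance R s)))}
    {H = 𝔼simMove (ℕtoℚ (K * K)) (κ (advance R s)) R (own s) (sim s)}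
    {Y = ℕtoℚ (K * K) ℚ.* 𝔼 (sim s) (λ τ → rcost τ (R ∷ Rs))}
    {F′ = 𝔼Φ (κ (advance R s)) (own s) (sim s)}
    {F = 𝔼Φ (κ s) (own s) (sim s)} {M = ℕtoℚ (reserve n K (κ s))}
    future
    (greedy-bound K R s isμ ok κ′≤K)
    (simCost-∷ (ℕtoℚ (K * K)) (κ (advance R s)) R (own s) (sim s) Rs)
    (raise-κ K (κ s) (3 * ∣ R ∣) (own s) (sim s) isμ κ′≤K)

  budget-initial : ∀ K (π₀ : Permutation′ n) Rs → budget K (run π₀ []) Rs ≡
    ℕtoℚ (K * K) ℚ.* rcost π₀ Rs ℚ.+ (ℕtoℚ (Φ 0 π₀ π₀) ℚ.+ ℕtoℚ (reserve n K 0))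
  budget-initial {n} K π₀ Rs = cong₂ (λ p q → ℕtoℚ (K * K) ℚ.* p ℚ.+ (q ℚ.+ ℕtoℚ (reserve n K 0)))
    (𝔼-pure π₀ (λ τ → rcost τ Rs)) (𝔼-pure π₀ (λ τ → ℕtoℚ (Φ 0 π₀ τ)))

detCost-bound : ∀ K (π₀ : Permutation′ n) hist Rs → κ (run π₀ hist) ≤ K → All (Admissible K) Rs →
  ℕtoℚ (detCostFrom detAlg π₀ hist (own (run π₀ hist)) Rs) ℚ.≤ budget K (run π₀ hist) Rs
detCost-bound K π₀ hist []       κ≤K []                    = 0≤budget K (run π₀ hist) (IsDist-sim π₀ hist)
detCost-bound K π₀ hist (R ∷ Rs) κ≤K ((ne , 3R≤K) ∷ oks) = ℚ.≤-trans
  (ℚ.≤-reflexive (trans (ℕtoℚ-+ (a + d) rest) (cong (ℚ._+ ℕtoℚ rest) (ℕtoℚ-+ a d))))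
  -- The maximum taken in `advance` makes `R` admissible for the new `κ`, even if `R` is larger than
  -- every earlier request.
  (budget-advance K (run π₀ hist) R Rs (IsDist-sim π₀ hist) (ne , m≤n⊔m (κ (run π₀ hist)) (3 * ∣ R ∣)) κ′≤K
    (detCost-bound K π₀ (R ∷ hist) Rs κ′≤K oks))
  where
  a = access (own (run π₀ hist)) R
  d = dist (own (run π₀ hist)) (own (run π₀ (R ∷ hist)))
  rest = detCostFrom detAlg π₀ (R ∷ hist) (own (run π₀ (R ∷ hist))) Rs
  κ′≤K = ⊔-lub κ≤K 3R≤K

-- Competitive ratios

valid⇒admissible : ∀ {r} {Rs : List (Subset n)} → ValidInput r Rs → All (Admissible (3 * r)) Rs
valid⇒admissible = All.map (λ (ne , R≤r) → ne , *-monoʳ-≤ 3 R≤r)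

expCost-bound : ∀ r (π₀ : Permutation′ n) Rs → ValidInput r Rs → ∀ σ →
  expCost randAlg π₀ Rs ℚ.≤ ℕtoℚ (81 * r ^ 2 * offCost π₀ σ Rs + maxΦ n (3 * r))
expCost-bound {n} r π₀ Rs valid σ = begin
  expCost randAlg π₀ Rs                                       ≡⟨ expCostFrom≡rcost π₀ [] Rs ⟩
  rcost π₀ Rs                                                 ≤⟨ rcost-bound K π₀ π₀ σ Rs (valid⇒admissible valid) ⟩
  ℕtoℚ (K * K * offCost π₀ σ Rs + Φ K π₀ π₀)                  ≤⟨ ℕtoℚ-mono (+-mono-≤ (*-monoˡ-≤ (offCost π₀ σ Rs) K²≤) (Φ≤maxΦ {K = K} ≤-refl π₀ π₀)) ⟩
  ℕtoℚ (81 * r ^ 2 * offCost π₀ σ Rs + maxΦ n K)              ∎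
  where
  open ℚ.≤-Reasoning
  K = 3 * r
  -- `K * K` is only `9 * r ^ 2`; 81 is the constant of the deterministic bound, the fourth power of
  -- 3, and serves for both.
  K²≤ : K * K ≤ 81 * r ^ 2
  K²≤ = ≤-trans (≤-reflexive (solve 1 (λ r → con 3 :* r :* (con 3 :* r) := con 9 :* r :^ 2) refl r))
    (*-monoˡ-≤ (r ^ 2) (m≤m+n 9 72))
    where open ℕ-Solver

-- Bounds for the initial potential of the simulation against the optimum, weighted by `K * K`, and
-- of the deterministic list against the simulation, then the full reserve at `κ = 0`.
detSlack : ℕ → ℕ → ℕ
detSlack n K = K * K * maxΦ n K + (maxΦ n K + reserve n K 0)

detAlg-bound : ∀ r (π₀ : Permutation′ n) Rs → ValidInput r Rs → ∀ σ →
  detCost detAlg π₀ Rs ≤ 81 * r ^ 4 * offCost π₀ σ Rs + detSlack n (3 * r)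
detAlg-bound {n} r π₀ Rs valid σ = ℕtoℚ-cancel-≤ (begin
  ℕtoℚ (detCost detAlg π₀ Rs)
    ≤⟨ detCost-bound K π₀ [] Rs z≤n (valid⇒admissible valid) ⟩
  budget K (run π₀ []) Rs
    ≡⟨ budget-initial K π₀ Rs ⟩
  c ℚ.* rcost π₀ Rs ℚ.+ (ℕtoℚ (Φ 0 π₀ π₀) ℚ.+ ℕtoℚ rsv)
    ≤⟨ ℚ.+-mono-≤ (*-monoˡ (0≤ℕtoℚ (K * K)) (rcost-bound K π₀ π₀ σ Rs (valid⇒admissible valid)))
         (ℚ.≤-reflexive (sym (ℕtoℚ-+ (Φ 0 π₀ π₀) rsv))) ⟩
  c ℚ.* ℕtoℚ (K * K * off + Φ K π₀ π₀) ℚ.+ ℕtoℚ (Φ 0 π₀ π₀ + rsv)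
    ≡⟨ cong (ℚ._+ ℕtoℚ (Φ 0 π₀ π₀ + rsv)) (ℕtoℚ-* (K * K) (K * K * off + Φ K π₀ π₀)) ⟨
  ℕtoℚ (K * K * (K * K * off + Φ K π₀ π₀)) ℚ.+ ℕtoℚ (Φ 0 π₀ π₀ + rsv)
    ≡⟨ ℕtoℚ-+ (K * K * (K * K * off + Φ K π₀ π₀)) (Φ 0 π₀ π₀ + rsv) ⟨
  ℕtoℚ (K * K * (K * K * off + Φ K π₀ π₀) + (Φ 0 π₀ π₀ + rsv))
    ≤⟨ ℕtoℚ-mono (+-mono-≤ (*-monoʳ-≤ (K * K) (+-monoʳ-≤ (K * K * off) (Φ≤maxΦ {K = K} ≤-refl π₀ π₀)))
                           (+-monoˡ-≤ rsv (Φ≤maxΦ {κ = 0} {K = K} z≤n π₀ π₀))) ⟩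
  ℕtoℚ (K * K * (K * K * off + maxΦ n K) + (maxΦ n K + rsv))
    ≡⟨ cong ℕtoℚ (solve 4 (λ r o m s →
         let k = con 3 :* r in k :* k :* (k :* k :* o :+ m) :+ s := con 81 :* r :^ 4 :* o :+ (k :* k :* m :+ s))
         refl r off (maxΦ n K) (maxΦ n K + rsv)) ⟩
  ℕtoℚ (81 * r ^ 4 * off + detSlack n K) ∎)
  where
  open ℚ.≤-Reasoning
  open ℕ-Solver
  K = 3 * r
  c = ℕtoℚ (K * K)
  off = offCost π₀ σ Rs
  rsv = reserve n K 0

theorem3 : Σ RandAlg λ A → Σ DetAlg λ B → ∃ λ (C : ℕ) → (r : ℕ) → 1 ≤ r → (n : ℕ) →
    (∃ λ (ξ : ℕ) → (π₀ : Permutation′ n) (Rs : List (Subset n)) → ValidInput r Rs →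
    (σ : ℕ → Permutation′ n) →
    expCost A π₀ Rs ℚ.≤ ℕtoℚ (C * r ^ 2 * offCost π₀ σ Rs + ξ))
    × (∃ λ (ξ : ℕ) → (π₀ : Permutation′ n) (Rs : List (Subset n)) → ValidInput r Rs →
    (σ : ℕ → Permutation′ n) →
    detCost B π₀ Rs ≤ C * r ^ 4 * offCost π₀ σ Rs + ξ)
theorem3 = randAlg , detAlg , 81 , λ r _ n →
  (maxΦ n (3 * r) , expCost-bound r) , (detSlack n (3 * r) , detAlg-bound r)
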